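{- Let $d$ be a positive integer. There are constants $C=C(d)$ (depending only on $d$) and $c>0$ such that the following holds. Let $\mathcal{H}$ be an ordered $3$-uniform hypergraph on $t$ vertices with maximum degree $d$ and let $s$ be a positive integer. Then \[\overline{R}(\mathcal{H},\mathcal{K}^{(3)}_3(s)) \leq t \cdot 2^{C s^{2-1/(1+cd^2)}}.\] In particular, for $s=t=n$ and bounded $d$, \[\overline{R}(\mathcal{H},\mathcal{K}^{(3)}_3(n)) \leq 2^{O(n^{2-1/(1+cd^2)})}.\]
   Context: An ordered $k$-uniform hypergraph is a pair $(H,<)$ of a $k$-uniform hypergraph $H$ and a linear ordering $<$ of its vertex set; $\mathcal{H}_1$ is an ordered subhypergraph of $\mathcal{H}_2$ if $H_1$ is a subhypergraph of $H_2$ and the order of $\mathcal{H}_1$ is the restriction of the order of $\mathcal{H}_2$; isomorphisms of ordered hypergraphs must preserve the orderings. $\mathcal{K}^{(k)}_N$ denotes the ordered complete $k$-uniform hypergraph on $N$ vertices. The ordered Ramsey number $\overline{R}(\mathcal{H},\mathcal{G})$ of ordered $k$-uniform hypergraphs $\mathcal{H},\mathcal{G}$ is the smallest $N$ such that every red-blue coloring of the hyperedges of $\mathcal{K}^{(k)}_N$ contains a blue ordered subhypergraph isomorphic to $\mathcal{H}$ or a red ordered subhypergraph isomorphic to $\mathcal{G}$. $\mathcal{K}^{(3)}_3(n)$ denotes the ordered complete $3$-uniform tripartite hypergraph whose vertex set consists of three consecutive intervals (all vertices of one precede all vertices of the next) of size $n$ each, with hyperedges exactly the triples containing one vertex from each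 interval. The degree of a vertex is the number of hyperedges containing it. -}

module Defs where

open import Data.Nat using (ℕ; _+_; _*_; _^_; _≤_; _<ᵇ_; _≡ᵇ_)
open import Data.Bool using (Bool; true; false; _∧_; _∨_; if_then_else_)
open import Data.Fin using (Fin; toℕ)
import Data.Fin as F
open import Data.List using (List; allFin; map)
open import Data.Nat.ListAction using (sum)
open import Data.Product using (Σ; _×_)
open import Data.Sum using (_⊎_)
open import Relation.Binary.PropositionalEquality using (_≡_)

-- An ordered 3-uniform hypergraph on t vertices: vertex set Fin t with its
-- natural order; the hyperedges are the triples i < j < k with E i j k ≡ true
-- (values of E on non-increasing triples are ignored).
record Hypergraph3 (t : ℕ) : Set where
  field
    E : Fin t → Fin t → Fin t → Bool
open Hypergraph3 public

increasing : ∀ {t} → Fin t → Fin t → Fin t → Bool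
increasing i j k = (toℕ i <ᵇ toℕ j) ∧ (toℕ j <ᵇ toℕ k)

contains : ∀ {t} → Fin t → Fin t → Fin t → Fin t → Bool
contains v i j k = (toℕ i ≡ᵇ toℕ v) ∨ (toℕ j ≡ᵇ toℕ v) ∨ (toℕ k ≡ᵇ toℕ v)

degree : ∀ {t} → Hypergraph3 t → Fin t → ℕ
degree {t} H v =
  sum (map (λ i → sum (map (λ j → sum (map (λ k →
    if increasing i j k ∧ E H i j k ∧ contains v i j k then 1 else 0)
    (allFin t))) (allFin t))) (allFin t))

MaxDegreeAtMost : ∀ {t} → Hypergraph3 t → ℕ → Set
MaxDegreeAtMost {t} H d = (v : Fin t) → degree H v ≤ d

StrictlyIncreasing : ∀ {m n} → (Fin m → Fin n) → Set
StrictlyIncreasing {m} f = (i j : Fin m) → i F.< j → f i F.< f j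

-- A red-blue colouring of the hyperedges of the ordered complete 3-graph
-- on Fin N: the colour of the hyperedge {i<j<k} is χ i j k
-- (true = red, false = blue); values on other triples are irrelevant.
Colouring : ℕ → Set
Colouring N = Fin N → Fin N → Fin N → Bool

BlueCopy : ∀ {N t} → Colouring N → Hypergraph3 t → Set
BlueCopy {N} {t} χ H =
  Σ (Fin t → Fin N) λ f → StrictlyIncreasing f ×
    ((i j k : Fin t) → increasing i j k ≡ true → E H i j k ≡ true →
      χ (f i) (f j) (f k) ≡ false)

RedK33 : ∀ {N} → Colouring N → ℕ → Set
RedK33 {N} χ s =
  Σ (Fin s → Fin N) λ a → Σ (Fin s → Fin N) λ b → Σ (Fin s → Fin N) λ c →
    StrictlyIncreasing a × StrictlyIncreasing b × StrictlyIncreasing c ×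
    ((i j : Fin s) → a i F.< b j) × ((i j : Fin s) → b i F.< c j) ×
    ((i j k : Fin s) → χ (a i) (b j) (c k) ≡ true)

Arrows : ℕ → ∀ {t} → Hypergraph3 t → ℕ → Set
Arrows N H s = (χ : Colouring N) → BlueCopy χ H ⊎ RedK33 χ s

-- ORamseyAtMost H s Bound  :⇔  R̄(H, K^(3)_3(s)) satisfies Bound, via: some N
-- with the Ramsey property satisfies Bound (R̄ is the least such N, and Bound
-- below is downward closed).  The bound is real-valued in the paper.
ORamseyAtMost : ∀ {t} → Hypergraph3 t → ℕ → (ℕ → Set) → Set
ORamseyAtMost H s Bound = Σ ℕ λ N → Arrows N H s × Bound N

-- LeTimesPow2 t C s a b N  :⇔  N ≤ t · 2^(C · s^(a/b))   (real exponent, b ≥ 1)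
-- encoded without reals: for all v ≥ 1 and every integer m ≥ v·C·s^(a/b)
-- (i.e. m^b ≥ (v·C)^b · s^a) we have N^v ≤ t^v · 2^m.  Letting m/v → C s^(a/b)
-- shows this is equivalent to the real inequality.
LeTimesPow2 : ℕ → ℕ → ℕ → ℕ → ℕ → ℕ → Set
LeTimesPow2 t C s a b N =
  (v m : ℕ) → 1 ≤ v → (v * C) ^ b * s ^ a ≤ m ^ b → N ^ v ≤ t ^ v * 2 ^ m

module Submission where

-- Put t consecutive intervals of size M one after another and embed the vertices of H from left
-- to right, the image of the i-th vertex inside the i-th interval.  For two intervals v, w let G v w
-- consist of the pairs forming blue triples with the images x of all earlier vertices for which
-- xvw is an edge.  The invariant is that G v w has density at least D^(-codegree) on every
-- box B × C with |B|, |C| ≥ M₁.  A next image is bad if it has few neighbours in some candidate set,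
-- which by density holds for fewer than M₁ points, or if its blue link is sparse on
-- some large box in some G v w.  If many p_i are bad in the second way, with boxes B_i × C_i, cut the
-- two intervals into the atoms of all the B_i and C_i: on every atom each box is everything or nothing, so
-- averaging over atoms gives one large atom on which many p_i are simultaneously almost completely red,
-- and a greedy choice there yields a red K(s,s,s).  Cutting costs a factor 2^(s·poly(D)), the greedy
-- choice 2^(s²/D), and these balance when D is a suitable root of s.

open import Defs
open import Data.Bool as Bool using (Bool; true; false; _∧_; not; if_then_else_)
open import Data.Bool.Properties using (∨-zeroʳ)
open import Data.Empty using (⊥; ⊥-elim)
open import Data.Fin using (Fin; zero; suc; toℕ; combine)
import Data.Fin as F
open import Data.Fin.Properties using (combine-monoˡ-<; toℕ-combine; toℕ-injective; toℕ<n; toℕ-fromℕ<)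
open import Data.Fin.Subset using (Subset)
open import Data.Fin.Subset.Properties using (anySubset?)
open import Data.List using (map; allFin)
import Data.List as List
open import Data.List.Properties using (map-tabulate)
open import Data.Nat
open import Data.Nat.DivMod using (m/n*n≤m; m*n/n≡m; /-monoˡ-≤; m≡m%n+[m/n]*n; m%n<n)
open import Data.Nat.ListAction using (sum)
open import Data.Nat.Properties
open import Algebra.Properties.Semiring.Sum +-*-semiring
  using (sum-cong-≗; ∑-distrib-+; ∑-comm; *-distribˡ-sum) renaming (sum to vecSum)
open import Data.Nat.Tactic.RingSolver using (solve-∀)
open import Data.Product using (Σ; ∃; _×_; _,_; proj₁; proj₂)
open import Data.Sum as Sum using (_⊎_; inj₁; inj₂)
open import Data.Vec using (lookup; tabulate)
open import Data.Vec.Functional using (updateAt)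
open import Data.Vec.Functional.Properties using (updateAt-updates; updateAt-minimal)
open import Data.Vec.Properties using (lookup∘tabulate)
open import Function using (_∘_; id; case_of_)
open import Relation.Binary.PropositionalEquality hiding (J)
open import Relation.Nullary using (¬_; Dec; yes; no; does; contradiction)
open import Relation.Nullary.Decidable using (_×-dec_)

-- Finite sums, Boolean indicators and counting.

opaque
  ∑ : ∀ {n} → (Fin n → ℕ) → ℕ
  ∑ = vecSum

  ∑-cong : ∀ {n} {f g : Fin n → ℕ} → (∀ i → f i ≡ g i) → ∑ f ≡ ∑ g
  ∑-cong = sum-cong-≗

  ∑-+ : ∀ {n} (f g : Fin n → ℕ) → ∑ (λ i → f i + g i) ≡ ∑ f + ∑ g
  ∑-+ = ∑-distrib-+

  ∑-swap : ∀ {m n} (f : Fin m → Fin n → ℕ) →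
    ∑ (λ i → ∑ (λ j → f i j)) ≡ ∑ (λ j → ∑ (λ i → f i j))
  ∑-swap = ∑-comm

  ∑-* : ∀ {n} c (f : Fin n → ℕ) → ∑ (λ i → c * f i) ≡ c * ∑ f
  ∑-* c f = sym (*-distribˡ-sum c f)

  ∑-mono : ∀ {n} {f g : Fin n → ℕ} → (∀ i → f i ≤ g i) → ∑ f ≤ ∑ g
  ∑-mono {zero} h = z≤n
  ∑-mono {suc n} h = +-mono-≤ (h zero) (∑-mono (h ∘ suc))

  ∑-const : ∀ n c → ∑ {n} (λ _ → c) ≡ n * c
  ∑-const zero c = refl
  ∑-const (suc n) c = cong (c +_) (∑-const n c)

  term≤∑ : ∀ {n} (f : Fin n → ℕ) i → f i ≤ ∑ f
  term≤∑ f zero = m≤m+n _ _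
  term≤∑ f (suc i) = ≤-trans (term≤∑ (f ∘ suc) i) (m≤n+m _ _)

  -- Averaging principle. It makes both averaging choices of the proof: the next element of the
  -- greedy selection and the next image in the embedding.
  ∑-< : ∀ {n} (f g : Fin n → ℕ) → ∑ f < ∑ g → ∃ λ i → f i < g i
  ∑-< {suc n} f g lt with f zero <? g zero
  ... | yes p = zero , p
  ... | no ¬p with ∑-< (f ∘ suc) (g ∘ suc)
        (+-cancelˡ-< (f zero) _ _ (<-≤-trans lt (+-monoˡ-≤ _ (≮⇒≥ ¬p))))
  ...   | i , q = suc i , q

⟦_⟧ : Bool → ℕ
⟦ b ⟧ = if b then 1 else 0

count : ∀ {n} → (Fin n → Bool) → ℕ
count X = ∑ (λ i → ⟦ X i ⟧)

⟦⟧≤1 : ∀ b → ⟦ b ⟧ ≤ 1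
⟦⟧≤1 true = ≤-refl
⟦⟧≤1 false = z≤n

⟦⟧-∧ : ∀ a b → ⟦ a ∧ b ⟧ ≡ ⟦ a ⟧ * ⟦ b ⟧
⟦⟧-∧ true b = sym (+-identityʳ _)
⟦⟧-∧ false b = refl

⟦⟧-split : ∀ a b → ⟦ a ⟧ ≡ ⟦ a ∧ b ⟧ + ⟦ a ∧ not b ⟧
⟦⟧-split true true = refl
⟦⟧-split true false = refl
⟦⟧-split false _ = refl

T⇒≡ : ∀ {b} → Bool.T b → b ≡ true
T⇒≡ {true} _ = refl

not-true : ∀ {b} → not b ≡ true → b ≡ false
not-true {false} _ = refl

∧-true : ∀ {a b} → a ∧ b ≡ true → a ≡ true × b ≡ true
∧-true {true} {true} _ = refl , refl

∧-intro : ∀ {a b} → a ≡ true → b ≡ true → a ∧ b ≡ true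
∧-intro refl refl = refl

⟦⟧-pos : ∀ {b} → 0 < ⟦ b ⟧ → b ≡ true
⟦⟧-pos {true} _ = refl

⟦⟧-zero : ∀ {b} → ⟦ b ⟧ ≡ 0 → b ≡ false
⟦⟧-zero {false} _ = refl

∑-zero : ∀ n → ∑ {n} (λ _ → 0) ≡ 0
∑-zero n = trans (∑-const n 0) (*-zeroʳ n)

count-cong : ∀ {n} {X Y : Fin n → Bool} → (∀ i → X i ≡ Y i) → count X ≡ count Y
count-cong h = ∑-cong (λ i → cong ⟦_⟧ (h i))

count-true : ∀ n → count {n} (λ _ → true) ≡ n
count-true n = trans (∑-const n 1) (*-identityʳ n)

count≤ : ∀ {n} (X : Fin n → Bool) → count X ≤ n
count≤ {n} X = ≤-trans (∑-mono (λ i → ⟦⟧≤1 (X i))) (≤-reflexive (count-true n))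

opaque
  unfolding ∑

  enumerate : ∀ {n} k (X : Fin n → Bool) → k ≤ count X →
    Σ (Fin k → Fin n) λ a → StrictlyIncreasing a × (∀ i → X (a i) ≡ true)
  enumerate zero X _ = (λ ()) , (λ ()) , λ ()
  enumerate {suc n} (suc k) X le with X zero in eq
  ... | false = let a , inc , h = enumerate (suc k) (X ∘ suc) le in
    suc ∘ a , (λ i j i<j → s<s (inc i j i<j)) , h
  ... | true = let a , inc , h = enumerate k (X ∘ suc) (≤-pred le) in
    (λ { zero → zero ; (suc i) → suc (a i) }) ,
    (λ { zero (suc j) _ → z<s ; (suc i) (suc j) i<j → s<s (inc i j (s<s⁻¹ i<j)) }) ,
    λ { zero → eq ; (suc i) → h i }

  -- The last component carries completeness over to the larger set: each of its members is either
  -- the new one or an old one.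
  count-insert : ∀ {n} (J : Fin n → Bool) i → J i ≡ false →
    Σ (Fin n → Bool) λ J′ → count J′ ≡ suc (count J) ×
      (∀ j → J′ j ≡ true → j ≡ i ⊎ J j ≡ true)
  count-insert J zero eq =
    (λ { zero → true ; (suc j) → J (suc j) }) ,
    cong (λ b → suc (⟦ b ⟧ + count (J ∘ suc))) (sym eq) ,
    λ { zero _ → inj₁ refl ; (suc j) h → inj₂ h }
  count-insert J (suc i) eq =
    let J′ , c , h = count-insert (J ∘ suc) i eq in
    (λ { zero → J zero ; (suc j) → J′ j }) ,
    trans (cong (⟦ J zero ⟧ +_) c) (+-suc _ _) ,
    λ { zero e → inj₂ e ; (suc j) e → case h j e of λ { (inj₁ refl) → inj₁ refl ; (inj₂ q) → inj₂ q } }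

-- A red configuration found at any single index ends the whole argument; otherwise the bounds for
-- all indices are available together.
∀⊎ : ∀ {ℓ} {A : Set ℓ} {n} {P : Fin n → Set} → (∀ i → A ⊎ P i) → A ⊎ (∀ i → P i)
∀⊎ {n = zero} h = inj₂ λ ()
∀⊎ {n = suc n} {P} h with h zero | ∀⊎ {P = P ∘ suc} (h ∘ suc)
... | inj₁ a | _ = inj₁ a
... | inj₂ _ | inj₁ a = inj₁ a
... | inj₂ p | inj₂ ps = inj₂ λ { zero → p ; (suc i) → ps i }

-- Greedy selection of complete bipartite patterns.

-- Abstract, so that the same greedy selection serves for single vertices and for pairs.
record Summation (T : Set) : Set where
  field
    μ : (T → ℕ) → ℕ
    μ-mono : ∀ {f g} → (∀ y → f y ≤ g y) → μ f ≤ μ g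
    μ-+ : ∀ f g → μ (λ y → f y + g y) ≡ μ f + μ g
    μ-* : ∀ c f → μ (λ y → c * f y) ≡ c * μ f
    μ-∑ : ∀ {n} (f : Fin n → T → ℕ) → μ (λ y → ∑ (λ i → f i y)) ≡ ∑ (λ i → μ (f i))

  μ-cong : ∀ {f g} → (∀ y → f y ≡ g y) → μ f ≡ μ g
  μ-cong h = ≤-antisym (μ-mono (≤-reflexive ∘ h)) (μ-mono (≤-reflexive ∘ sym ∘ h))

∑-summation : ∀ n → Summation (Fin n)
∑-summation n = record
  { μ = ∑ ; μ-mono = ∑-mono ; μ-+ = ∑-+ ; μ-* = ∑-* ; μ-∑ = λ f → ∑-swap (λ y i → f i y) }

∑∑ : ∀ {m n} → (Fin m × Fin n → ℕ) → ℕ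
∑∑ f = ∑ λ b → ∑ λ c → f (b , c)

∑∑-summation : ∀ m n → Summation (Fin m × Fin n)
∑∑-summation m n = record
  { μ = ∑∑
  ; μ-mono = λ h → ∑-mono λ b → ∑-mono λ c → h (b , c)
  ; μ-+ = λ f g → trans (∑-cong λ b → ∑-+ (λ c → f (b , c)) (λ c → g (b , c))) (∑-+ _ _)
  ; μ-* = λ c f → trans (∑-cong λ b → ∑-* c (λ x → f (b , x))) (∑-* c _)
  ; μ-∑ = λ f → trans (∑-cong λ b → ∑-swap (λ c i → f i (b , c)))
                      (∑-swap (λ b i → ∑ λ c → f i (b , c))) }

-- The slack den * s keeps every y related to a num/den fraction of the part of I not yet selected.
module Greedy {T : Set} (S : Summation T) {n : ℕ} (I : Fin n → Bool)
  (rel : Fin n → T → Bool) (Y₀ : T → Bool) (num den s : ℕ) (1≤den : 1 ≤ den)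
  (rich : ∀ y → Y₀ y ≡ true →
     num * count I + den * s ≤ den * count (λ i → I i ∧ rel i y)) where

  open Summation S

  ∣_∣ : (T → Bool) → ℕ
  ∣ Y ∣ = μ (λ y → ⟦ Y y ⟧)

  -- Each selection multiplies the surviving part of `Y₀` by at least `num / den`; `large` is this
  -- bound with denominators cleared.
  record Stage (k : ℕ) : Set where
    field
      J : Fin n → Bool
      Y : T → Bool
      Y⊆Y₀ : ∀ y → Y y ≡ true → Y₀ y ≡ true
      complete : ∀ i y → J i ≡ true → Y y ≡ true → rel i y ≡ true
      ∣J∣ : count J ≡ k
      large : ∣ Y₀ ∣ * num ^ k ≤ ∣ Y ∣ * den ^ k
      nonempty : 1 ≤ ∣ Y ∣

  start : 1 ≤ ∣ Y₀ ∣ → Stage 0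
  start h = record
    { J = λ _ → false ; Y = Y₀ ; Y⊆Y₀ = λ _ → id
    ; complete = λ _ _ () ; ∣J∣ = ∑-zero n ; large = ≤-refl ; nonempty = h }

  extend : ∀ {k} → k < s → Stage k → Stage (suc k)
  extend {k} k<s st = record
    { J = J′ ; Y = Y′
    ; Y⊆Y₀ = λ y e → Y⊆Y₀ y (proj₁ (∧-true e))
    ; complete = λ j y e e′ → case J′⊆ j e of λ
        { (inj₁ refl) → proj₂ (∧-true e′) ; (inj₂ q) → complete j y q (proj₁ (∧-true e′)) }
    ; ∣J∣ = trans cJ′ (cong suc ∣J∣)
    ; large = large′
    ; nonempty = nonempty′ }
    where
    open Stage st
    gain : Fin n → T → ℕ
    gain i y = ⟦ Y y ⟧ * ⟦ (I i ∧ not (J i)) ∧ rel i y ⟧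
    -- The `k` elements already selected cost at most `den * k`. As `k < s`, the slack `den * s`
    -- pays for them and leaves at least 1 for each `y` in `Y`, which makes the averaging strict.
    gain-large : ∀ y → num * count I * ⟦ Y y ⟧ + ⟦ Y y ⟧ ≤ den * ∑ (λ i → gain i y)
    gain-large y with Y y in eq
    ... | false = subst (_≤ den * ∑ {n} (λ _ → 0))
                    (sym (trans (+-identityʳ _) (*-zeroʳ (num * count I)))) z≤n
    ... | true = +-cancelʳ-≤ (den * k) _ _ (begin
        num * count I * 1 + 1 + den * k
          ≡⟨ ring (num * count I) (den * k) ⟩
        num * count I + (1 + den * k)
          ≤⟨ +-monoʳ-≤ _ (+-monoˡ-≤ (den * k) 1≤den) ⟩
        num * count I + (den + den * k)
          ≡⟨ cong (num * count I +_) (*-suc den k) ⟨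
        num * count I + den * suc k
          ≤⟨ +-monoʳ-≤ _ (*-monoʳ-≤ den k<s) ⟩
        num * count I + den * s
          ≤⟨ rich y (Y⊆Y₀ y eq) ⟩
        den * count (λ i → I i ∧ rel i y)
          ≤⟨ *-monoʳ-≤ den unused ⟩
        den * (∑ (λ i → 1 * ⟦ (I i ∧ not (J i)) ∧ rel i y ⟧) + k)
          ≡⟨ *-distribˡ-+ den _ k ⟩
        _ ∎)
      where
      open ≤-Reasoning
      ring : ∀ a b → a * 1 + 1 + b ≡ a + (1 + b)
      ring = solve-∀
      bound : ∀ a b c → ⟦ a ∧ c ⟧ ≤ 1 * ⟦ (a ∧ not b) ∧ c ⟧ + ⟦ b ⟧
      bound false b c = z≤n
      bound true true c = ⟦⟧≤1 c
      bound true false c = ≤-reflexive (sym (trans (+-identityʳ _) (+-identityʳ _)))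
      unused : count (λ i → I i ∧ rel i y) ≤ ∑ (λ i → 1 * ⟦ (I i ∧ not (J i)) ∧ rel i y ⟧) + k
      unused = begin
        count (λ i → I i ∧ rel i y) ≤⟨ ∑-mono (λ i → bound (I i) (J i) (rel i y)) ⟩
        _ ≡⟨ ∑-+ (λ i → 1 * ⟦ (I i ∧ not (J i)) ∧ rel i y ⟧) (λ i → ⟦ J i ⟧) ⟩
        _ ≡⟨ cong (∑ (λ i → 1 * ⟦ (I i ∧ not (J i)) ∧ rel i y ⟧) +_) ∣J∣ ⟩
        _ ∎
    total : ∑ (λ i → num * ∣ Y ∣ * ⟦ I i ⟧) < ∑ (λ i → den * μ (gain i))
    total = begin-strict
      ∑ (λ i → num * ∣ Y ∣ * ⟦ I i ⟧)
        ≡⟨ ∑-* (num * ∣ Y ∣) (λ i → ⟦ I i ⟧) ⟩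
      num * ∣ Y ∣ * count I
        ≡⟨ ring num ∣ Y ∣ (count I) ⟩
      num * count I * ∣ Y ∣
        <⟨ m<m+n _ nonempty ⟩
      num * count I * ∣ Y ∣ + ∣ Y ∣
        ≡⟨ cong (_+ ∣ Y ∣) (μ-* (num * count I) (λ y → ⟦ Y y ⟧)) ⟨
      μ (λ y → num * count I * ⟦ Y y ⟧) + ∣ Y ∣
        ≡⟨ μ-+ _ _ ⟨
      μ (λ y → num * count I * ⟦ Y y ⟧ + ⟦ Y y ⟧)
        ≤⟨ μ-mono gain-large ⟩
      μ (λ y → den * ∑ (λ i → gain i y))
        ≡⟨ μ-* den _ ⟩
      den * μ (λ y → ∑ (λ i → gain i y))
        ≡⟨ cong (den *_) (μ-∑ gain) ⟩
      den * ∑ (λ i → μ (gain i))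
        ≡⟨ ∑-* den (λ i → μ (gain i)) ⟨
      ∑ (λ i → den * μ (gain i)) ∎
      where
      open ≤-Reasoning
      ring : ∀ a b c → a * b * c ≡ a * c * b
      ring = solve-∀
    choice : ∃ λ i → num * ∣ Y ∣ * ⟦ I i ⟧ < den * μ (gain i)
    choice = ∑-< _ _ total
    i = proj₁ choice
    Y′ : T → Bool
    Y′ y = Y y ∧ rel i y
    -- An index outside `I` or already selected has gain 0, so strictness forces the index found by
    -- averaging to be new.
    vanish : ∀ {a} → a < den * μ (λ y → ⟦ Y y ⟧ * 0) → ⊥
    vanish {a} lt with () ← subst (a <_)
      (trans (cong (den *_) (trans (μ-cong (λ y → *-comm ⟦ Y y ⟧ 0)) (μ-* 0 (λ y → ⟦ Y y ⟧))))
             (*-zeroʳ den)) lt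
    new : J i ≡ false × num * ∣ Y ∣ < den * ∣ Y′ ∣
    new with I i | J i | proj₂ choice
    ... | true | false | lt = refl , subst₂ _<_ (*-identityʳ _)
            (cong (den *_) (μ-cong λ y → sym (⟦⟧-∧ (Y y) (rel i y)))) lt
    ... | true | true | lt = ⊥-elim (vanish lt)
    ... | false | _ | lt = ⊥-elim (vanish lt)
    inserted = count-insert J i (proj₁ new)
    J′ = proj₁ inserted
    cJ′ = proj₁ (proj₂ inserted)
    J′⊆ = proj₂ (proj₂ inserted)
    large′ : ∣ Y₀ ∣ * num ^ suc k ≤ ∣ Y′ ∣ * den ^ suc k
    large′ = begin
      ∣ Y₀ ∣ * (num * num ^ k) ≡⟨ ring₁ ∣ Y₀ ∣ num (num ^ k) ⟩
      num * (∣ Y₀ ∣ * num ^ k) ≤⟨ *-monoʳ-≤ num large ⟩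
      num * (∣ Y ∣ * den ^ k)  ≡⟨ *-assoc num ∣ Y ∣ _ ⟨
      num * ∣ Y ∣ * den ^ k    ≤⟨ *-monoˡ-≤ (den ^ k) (<⇒≤ (proj₂ new)) ⟩
      den * ∣ Y′ ∣ * den ^ k   ≡⟨ ring₂ den ∣ Y′ ∣ (den ^ k) ⟩
      ∣ Y′ ∣ * (den * den ^ k) ∎
      where
      open ≤-Reasoning
      ring₁ : ∀ a b c → a * (b * c) ≡ b * (a * c)
      ring₁ = solve-∀
      ring₂ : ∀ a b c → a * b * c ≡ b * (a * c)
      ring₂ = solve-∀
    nonempty′ : 1 ≤ ∣ Y′ ∣
    nonempty′ with ∣ Y′ ∣ | proj₂ new
    ... | suc _ | _ = s≤s z≤n
    ... | zero | lt with () ← subst (num * ∣ Y ∣ <_) (*-zeroʳ den) lt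

  run : ∀ k → k ≤ s → 1 ≤ ∣ Y₀ ∣ → Stage k
  run zero _ h = start h
  run (suc k) k<s h = extend k<s (run k (<⇒≤ k<s) h)

  select : 1 ≤ ∣ Y₀ ∣ → Stage s
  select = run s ≤-refl

-- Restricted sums and cutting into atoms.

∑∈ : ∀ {n} → (Fin n → Bool) → (Fin n → ℕ) → ℕ
∑∈ X f = ∑ (λ i → ⟦ X i ⟧ * f i)

∑∈-split : ∀ {n} (X S : Fin n → Bool) f →
  ∑∈ X f ≡ ∑∈ (λ i → X i ∧ S i) f + ∑∈ (λ i → X i ∧ not (S i)) f
∑∈-split X S f = trans
  (∑-cong λ i → trans (cong (_* f i) (⟦⟧-split (X i) (S i)))
                      (*-distribʳ-+ (f i) ⟦ X i ∧ S i ⟧ ⟦ X i ∧ not (S i) ⟧))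
  (∑-+ _ _)

∑∈-full : ∀ {n} (f : Fin n → ℕ) → ∑∈ (λ _ → true) f ≡ ∑ f
∑∈-full f = ∑-cong λ i → +-identityʳ (f i)

record Atom {M m} (φ ψ : Fin M → ℕ) (B : Fin m → Fin M → Bool) (X : Fin M → Bool) (w : ℕ) : Set where
  field
    X′ : Fin M → Bool
    β : Fin m → Bool
    X′⊆X : ∀ b → X′ b ≡ true → X b ≡ true
    constant : ∀ i b → X′ b ≡ true → B i b ≡ β i
    excess : ∑∈ X′ ψ + w ≤ ∑∈ X′ φ

-- Cutting along each B i and always keeping the half of larger excess loses at most a factor 2 per cut.
atom : ∀ {M} m (φ ψ : Fin M → ℕ) (B : Fin m → Fin M → Bool) X w →
  ∑∈ X ψ + 2 ^ m * w ≤ ∑∈ X φ → Atom φ ψ B X w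
atom zero φ ψ B X w le = record
  { X′ = X ; β = λ () ; X′⊆X = λ _ → id ; constant = λ ()
  ; excess = subst (λ z → ∑∈ X ψ + z ≤ ∑∈ X φ) (+-identityʳ w) le }
atom (suc m) φ ψ B X w le = case (≤-total (q₁ + h) p₁) of λ
  { (inj₁ le₁) → record
      { X′ = A.X′ le₁ ; β = λ { zero → true ; (suc i) → A.β le₁ i }
      ; X′⊆X = λ b e → proj₁ (∧-true (A.X′⊆X le₁ b e))
      ; constant = λ { zero b e → proj₂ (∧-true (A.X′⊆X le₁ b e)) ; (suc i) b e → A.constant le₁ i b e }
      ; excess = A.excess le₁ }
  ; (inj₂ ge) → let le₂ = second ge in record
      { X′ = A′.X′ le₂ ; β = λ { zero → false ; (suc i) → A′.β le₂ i }
      ; X′⊆X = λ b e → proj₁ (∧-true {X b} (A′.X′⊆X le₂ b e))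
      ; constant = λ { zero b e → not-true (proj₂ (∧-true {X b} (A′.X′⊆X le₂ b e))) ; (suc i) b e → A′.constant le₂ i b e }
      ; excess = A′.excess le₂ } }
  where
  X₁ X₂ : Fin _ → Bool
  X₁ b = X b ∧ B zero b
  X₂ b = X b ∧ not (B zero b)
  p₁ = ∑∈ X₁ φ
  p₂ = ∑∈ X₂ φ
  q₁ = ∑∈ X₁ ψ
  q₂ = ∑∈ X₂ ψ
  h = 2 ^ m * w
  module A (le₁ : q₁ + h ≤ p₁) = Atom (atom m φ ψ (B ∘ suc) X₁ w le₁)
  module A′ (le₂ : q₂ + h ≤ p₂) = Atom (atom m φ ψ (B ∘ suc) X₂ w le₂)
  -- The total excess is at least `2 * h`, so if the first half has at most `h`, the second has at
  -- least `h`.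
  second : p₁ ≤ q₁ + h → q₂ + h ≤ p₂
  second ge = +-cancelˡ-≤ (q₁ + h) _ _ (begin
    q₁ + h + (q₂ + h) ≡⟨ ring q₁ q₂ (2 ^ m) w ⟩
    q₁ + q₂ + 2 ^ suc m * w ≡⟨ cong (_+ 2 ^ suc m * w) (∑∈-split X (B zero) ψ) ⟨
    ∑∈ X ψ + 2 ^ suc m * w ≤⟨ le ⟩
    ∑∈ X φ ≡⟨ ∑∈-split X (B zero) φ ⟩
    p₁ + p₂ ≤⟨ +-monoˡ-≤ p₂ ge ⟩
    q₁ + h + p₂ ∎)
    where
    open ≤-Reasoning
    ring : ∀ a b c w → a + c * w + (b + c * w) ≡ a + b + 2 * c * w
    ring = solve-∀

-- Powers, double sums and boxes.

^-distrib-* : ∀ m n k → (m * n) ^ k ≡ m ^ k * n ^ k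
^-distrib-* m n zero = refl
^-distrib-* m n (suc k) = trans (cong (m * n *_) (^-distrib-* m n k)) (ring m n (m ^ k) (n ^ k))
  where
  ring : ∀ a b c d → a * b * (c * d) ≡ a * c * (b * d)
  ring = solve-∀

∑∈-∑ : ∀ {m n} (X : Fin m → Bool) (f : Fin m → Fin n → ℕ) →
  ∑∈ X (λ b → ∑ (f b)) ≡ ∑ (λ c → ∑∈ X (λ b → f b c))
∑∈-∑ X f = trans (∑-cong λ b → sym (∑-* ⟦ X b ⟧ (f b))) (∑-swap _)

∑∈-box : ∀ {m n} (X : Fin m → Bool) (Y : Fin n → Bool) (f : Fin m → Fin n → ℕ) →
  ∑∈ Y (λ c → ∑∈ X (λ b → f b c)) ≡ ∑∑ (λ (b , c) → ⟦ X b ∧ Y c ⟧ * f b c)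
∑∈-box X Y f = begin
  ∑∈ Y (λ c → ∑∈ X (λ b → f b c))
    ≡⟨ ∑∈-∑ Y (λ c b → ⟦ X b ⟧ * f b c) ⟩
  ∑ (λ b → ∑ (λ c → ⟦ Y c ⟧ * (⟦ X b ⟧ * f b c)))
    ≡⟨ ∑-cong (λ b → ∑-cong (λ c → trans (ring ⟦ Y c ⟧ ⟦ X b ⟧ (f b c))
         (cong (_* f b c) (sym (⟦⟧-∧ (X b) (Y c)))))) ⟩
  ∑∑ (λ (b , c) → ⟦ X b ∧ Y c ⟧ * f b c) ∎
  where
  open ≡-Reasoning
  ring : ∀ a b c → a * (b * c) ≡ b * a * c
  ring = solve-∀

∑∑-swap₃ : ∀ {k m n} (f : Fin k → Fin m → Fin n → ℕ) →
  ∑ (λ i → ∑ (λ b → ∑ (λ c → f i b c))) ≡ ∑ (λ b → ∑ (λ c → ∑ (λ i → f i b c)))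
∑∑-swap₃ f = trans (∑-swap _) (∑-cong λ b → ∑-swap _)

∑∑-count : ∀ {m n} (X : Fin m → Bool) (Y : Fin n → Bool) →
  ∑∑ (λ (b , c) → ⟦ X b ∧ Y c ⟧) ≡ count X * count Y
∑∑-count X Y = begin
  ∑ (λ b → ∑ (λ c → ⟦ X b ∧ Y c ⟧)) ≡⟨ ∑-cong (λ b → trans (∑-cong (λ c → ⟦⟧-∧ (X b) (Y c))) (∑-* ⟦ X b ⟧ _)) ⟩
  ∑ (λ b → ⟦ X b ⟧ * count Y) ≡⟨ ∑-cong (λ b → *-comm ⟦ X b ⟧ (count Y)) ⟩
  ∑ (λ b → count Y * ⟦ X b ⟧) ≡⟨ ∑-* (count Y) _ ⟩
  count Y * count X ≡⟨ *-comm (count Y) _ ⟩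
  count X * count Y ∎
  where open ≡-Reasoning

-- The edge count e(B, C) of the bipartite graph `f`.
inBox : ∀ {M} (B C : Fin M → Bool) (f : Fin M → Fin M → Bool) → ℕ
inBox B C f = ∑ λ b → ∑ λ c → ⟦ B b ⟧ * (⟦ C c ⟧ * ⟦ f b c ⟧)

-- A red block from many boxes with few blue pairs.

record RedBlock {M m : ℕ} (red : Fin m → Fin M → Fin M → Bool) (s : ℕ) : Set where
  field
    A′ : Fin m → Bool
    B′ C′ : Fin M → Bool
    s≤A : s ≤ count A′
    s≤B : s ≤ count B′
    s≤C : s ≤ count C′
    allRed : ∀ i b c → A′ i ≡ true → B′ b ≡ true → C′ c ≡ true → red i b c ≡ true

-- Every box contains at least `M * M / Θ` pairs of `G`, of which at most a 1/(16r) part is blue for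
-- its index. After passing to one atom, a first greedy round fixes `s` indices and a second one `s`
-- rows; at least `s` columns survive both.
module _ {M m s r Θ Λ W ρ : ℕ} (1≤s : 1 ≤ s) (1≤r : 1 ≤ r) (1≤Θ : 1 ≤ Θ) (1≤Λ : 1 ≤ Λ)
  (m≡ : m ≡ 16 * Θ * (r * s)) (M≡ : M ≡ 4 ^ m * W) (1+ρ≡2r : suc ρ ≡ 2 * r)
  (Λ-large : (2 * r) ^ s ≤ Λ * ρ ^ s) (1≤W : 1 ≤ W)
  (W-large : m * (2 * (8 * Θ * Λ) * ((4 * (8 * Θ * Λ)) ^ s * s)) ≤ W)
  (red : Fin m → Fin M → Fin M → Bool) (G : Fin M → Fin M → Bool)
  (B C : Fin m → Fin M → Bool)
  (G-large : ∀ i → M * M ≤ Θ * inBox (B i) (C i) G)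
  (blue-small : ∀ i → 16 * r * inBox (B i) (C i) (λ b c → G b c ∧ not (red i b c))
                        ≤ inBox (B i) (C i) G) where

  private
    g bl : Fin m → ℕ
    g i = inBox (B i) (C i) G
    bl i = inBox (B i) (C i) (λ b c → G b c ∧ not (red i b c))
    κ = 4 * (r * s)
    -- Chosen so that `M * M` is `4 ^ m * w`: the initial excess `M * M` is halved by `m` cuts of
    -- the rows and `m` cuts of the columns.
    w = 4 ^ m * (W * W)
    -- On an atom where φ outweighs ψ, at most a 1/(8r) fraction is blue, and the term κ forces G to be dense there.
    φ ψ ψ′ : Fin M → Fin M → ℕ
    φ b c = ∑ λ i → ⟦ B i b ⟧ * (⟦ C i c ⟧ * ⟦ G b c ⟧)
    ψ′ b c = ∑ λ i → ⟦ B i b ⟧ * (⟦ C i c ⟧ * ⟦ G b c ∧ not (red i b c) ⟧)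
    ψ b c = 8 * r * ψ′ b c + κ
    open Summation (∑∑-summation M M)

    ∑φ : ∑ (λ b → ∑ (φ b)) ≡ ∑ g
    ∑φ = sym (∑∑-swap₃ _)

    ∑ψ : ∑ (λ b → ∑ (ψ b)) ≡ 8 * r * ∑ bl + κ * (M * M)
    ∑ψ = begin
      μ (λ (b , c) → ψ b c) ≡⟨ μ-+ _ _ ⟩
      μ (λ (b , c) → 8 * r * ψ′ b c) + μ (λ _ → κ)
        ≡⟨ cong₂ _+_ (μ-* (8 * r) _) (trans (∑-cong λ _ → ∑-const M κ) (∑-const M (M * κ))) ⟩
      8 * r * μ (λ (b , c) → ψ′ b c) + M * (M * κ)
        ≡⟨ cong₂ _+_ (cong (8 * r *_) (sym (∑∑-swap₃ _))) (ring M κ) ⟩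
      8 * r * ∑ bl + κ * (M * M) ∎
      where
      open ≡-Reasoning
      ring : ∀ a b → a * (a * b) ≡ b * (a * a)
      ring = solve-∀

    1≤rs : 1 ≤ r * s
    1≤rs = *-mono-≤ 1≤r 1≤s

    4^m*w : 2 ^ m * (2 ^ m * w) ≡ M * M
    4^m*w = begin
      2 ^ m * (2 ^ m * w) ≡⟨ *-assoc (2 ^ m) (2 ^ m) w ⟨
      2 ^ m * 2 ^ m * w ≡⟨ cong (_* w) (^-distrib-* 2 2 m) ⟨
      4 ^ m * (4 ^ m * (W * W)) ≡⟨ ring (4 ^ m) W ⟩
      4 ^ m * W * (4 ^ m * W) ≡⟨ cong₂ _*_ M≡ M≡ ⟨
      M * M ∎
      where
      open ≡-Reasoning
      ring : ∀ a b → a * (a * (b * b)) ≡ a * b * (a * b)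
      ring = solve-∀

    ∑g-large : 16 * (r * s) * (M * M) ≤ ∑ g
    ∑g-large = *-cancelˡ-≤ Θ {{>-nonZero 1≤Θ}} (begin
      Θ * (16 * (r * s) * (M * M)) ≡⟨ ring Θ (r * s) (M * M) ⟩
      16 * Θ * (r * s) * (M * M) ≡⟨ cong (_* (M * M)) m≡ ⟨
      m * (M * M) ≡⟨ ∑-const m (M * M) ⟨
      ∑ {m} (λ _ → M * M) ≤⟨ ∑-mono G-large ⟩
      ∑ (λ i → Θ * g i) ≡⟨ ∑-* Θ g ⟩
      Θ * ∑ g ∎)
      where
      open ≤-Reasoning
      ring : ∀ a b c → a * (16 * b * c) ≡ 16 * a * b * c
      ring = solve-∀

    ∑bl-small : 16 * r * ∑ bl ≤ ∑ g
    ∑bl-small = ≤-trans (≤-reflexive (sym (∑-* (16 * r) bl))) (∑-mono blue-small)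

    -- After doubling, the blue term takes at most one copy of `∑ g`. The other copy is at least
    -- 16rs times `M * M`, which covers 8rs times `M * M` for `κ` and 2 times `M * M` for the
    -- excess.
    initial : ∑∈ (λ _ → true) (λ b → ∑ (ψ b)) + 2 ^ m * (2 ^ m * w) ≤ ∑∈ (λ _ → true) (λ b → ∑ (φ b))
    initial = *-cancelˡ-≤ 2 (begin
      2 * (∑∈ (λ _ → true) (λ b → ∑ (ψ b)) + 2 ^ m * (2 ^ m * w))
        ≡⟨ cong₂ (λ x y → 2 * (x + y)) (trans (∑∈-full _) ∑ψ) 4^m*w ⟩
      2 * (8 * r * ∑ bl + κ * (M * M) + M * M)
        ≡⟨ ring r (∑ bl) (r * s) (M * M) ⟩
      16 * r * ∑ bl + (8 * (r * s) * (M * M) + 2 * 1 * (M * M))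
        ≤⟨ +-monoʳ-≤ (16 * r * ∑ bl) (+-monoʳ-≤ (8 * (r * s) * (M * M))
             (*-monoˡ-≤ (M * M) (*-mono-≤ {2} {8} (s≤s (s≤s z≤n)) 1≤rs))) ⟩
      16 * r * ∑ bl + (8 * (r * s) * (M * M) + 8 * (r * s) * (M * M))
        ≡⟨ cong (16 * r * ∑ bl +_) (ring′ (r * s) (M * M)) ⟩
      16 * r * ∑ bl + 16 * (r * s) * (M * M)
        ≤⟨ +-mono-≤ ∑bl-small ∑g-large ⟩
      ∑ g + ∑ g
        ≡⟨ cong (∑ g +_) (+-identityʳ (∑ g)) ⟨
      2 * ∑ g
        ≡⟨ cong (2 *_) (trans (∑∈-full _) ∑φ) ⟨
      2 * ∑∈ (λ _ → true) (λ b → ∑ (φ b)) ∎)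
      where
      open ≤-Reasoning
      ring : ∀ r b x q → 2 * (8 * r * b + 4 * x * q + q) ≡ 16 * r * b + (8 * x * q + 2 * 1 * q)
      ring = solve-∀
      ring′ : ∀ x q → 8 * x * q + 8 * x * q ≡ 16 * x * q
      ring′ = solve-∀

    record AtomBox : Set where
      field
        XB XC : Fin M → Bool
        β ζ : Fin m → Bool
        B-constant : ∀ i b → XB b ≡ true → B i b ≡ β i
        C-constant : ∀ i c → XC c ≡ true → C i c ≡ ζ i
        excess : ∑∈ XC (λ c → ∑∈ XB (λ b → ψ b c)) + w ≤ ∑∈ XC (λ c → ∑∈ XB (λ b → φ b c))

    atomBox : AtomBox
    atomBox = record
      { XB = rows.X′ ; XC = columns.X′ ; β = rows.β ; ζ = columns.β
      ; B-constant = rows.constant ; C-constant = columns.constant ; excess = columns.excess }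
      where
      module rows = Atom (atom m (λ b → ∑ (φ b)) (λ b → ∑ (ψ b)) B (λ _ → true) (2 ^ m * w) initial)
      -- The columns are cut after the rows, with the weights restricted to the surviving rows.
      module columns = Atom (atom m (λ c → ∑∈ rows.X′ (λ b → φ b c)) (λ c → ∑∈ rows.X′ (λ b → ψ b c))
        C (λ _ → true) w
        (subst₂ (λ x y → x + 2 ^ m * w ≤ y)
          (trans (∑∈-∑ rows.X′ ψ) (sym (∑∈-full _))) (trans (∑∈-∑ rows.X′ φ) (sym (∑∈-full _))) rows.excess))

  private module Refine (atomic : AtomBox) where
    open AtomBox atomic

    Pair = Fin M × Fin M
    X GX : Pair → Bool
    X (b , c) = XB b ∧ XC c
    GX (b , c) = X (b , c) ∧ G b c
    I : Fin m → Bool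
    I i = β i ∧ ζ i
    n = count I
    ∣_∣ : (Pair → Bool) → ℕ
    ∣ Y ∣ = μ (λ y → ⟦ Y y ⟧)
    blueI : Pair → ℕ
    blueI (b , c) = count (λ i → I i ∧ not (red i b c))

    -- Each box contains the whole atom if its index lies in `I` and misses it otherwise, so `φ` has
    -- the value `n` on all pairs of `G` in the atom.
    φ-point : ∀ b c → ⟦ X (b , c) ⟧ * φ b c ≡ n * ⟦ GX (b , c) ⟧
    φ-point b c with XB b in eb | XC c in ec | G b c
    ... | false | _ | _ = sym (*-zeroʳ n)
    ... | true | false | _ = sym (*-zeroʳ n)
    ... | true | true | γ = trans (+-identityʳ _) (begin
      ∑ (λ i → ⟦ B i b ⟧ * (⟦ C i c ⟧ * ⟦ γ ⟧))
        ≡⟨ ∑-cong (λ i → trans (cong₂ (λ x y → ⟦ x ⟧ * (⟦ y ⟧ * ⟦ γ ⟧)) (B-constant i b eb) (C-constant i c ec))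
             (trans (ring ⟦ β i ⟧ ⟦ ζ i ⟧ ⟦ γ ⟧) (cong (⟦ γ ⟧ *_) (sym (⟦⟧-∧ (β i) (ζ i)))))) ⟩
      ∑ (λ i → ⟦ γ ⟧ * ⟦ I i ⟧) ≡⟨ ∑-* ⟦ γ ⟧ _ ⟩
      ⟦ γ ⟧ * n ≡⟨ *-comm ⟦ γ ⟧ n ⟩
      n * ⟦ γ ⟧ ∎)
      where
      open ≡-Reasoning
      ring : ∀ a b c → a * (b * c) ≡ c * (a * b)
      ring = solve-∀

    ψ-point : ∀ b c → ⟦ X (b , c) ⟧ * ψ b c ≡ 8 * r * (⟦ GX (b , c) ⟧ * blueI (b , c)) + κ * ⟦ X (b , c) ⟧
    ψ-point b c with XB b in eb | XC c in ec | G b c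
    ... | false | _ | _ = sym (cong₂ _+_ (*-zeroʳ (8 * r)) (*-zeroʳ κ))
    ... | true | false | _ = sym (cong₂ _+_ (*-zeroʳ (8 * r)) (*-zeroʳ κ))
    ... | true | true | γ = trans (+-identityʳ _) (cong₂ (λ x y → 8 * r * x + y) (begin
      ∑ (λ i → ⟦ B i b ⟧ * (⟦ C i c ⟧ * ⟦ γ ∧ not (red i b c) ⟧))
        ≡⟨ ∑-cong (λ i → trans
             (cong₂ (λ x y → ⟦ x ⟧ * (⟦ y ⟧ * ⟦ γ ∧ not (red i b c) ⟧)) (B-constant i b eb) (C-constant i c ec))
             (rearrange (β i) (ζ i) γ (not (red i b c)))) ⟩
      ∑ (λ i → ⟦ γ ⟧ * ⟦ I i ∧ not (red i b c) ⟧) ≡⟨ ∑-* ⟦ γ ⟧ _ ⟩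
      ⟦ γ ⟧ * blueI (b , c) ∎) (sym (*-identityʳ κ)))
      where
      open ≡-Reasoning
      rearrange : ∀ p q a x → ⟦ p ⟧ * (⟦ q ⟧ * ⟦ a ∧ x ⟧) ≡ ⟦ a ⟧ * ⟦ (p ∧ q) ∧ x ⟧
      rearrange false q a x = sym (*-zeroʳ ⟦ a ⟧)
      rearrange true false a x = sym (*-zeroʳ ⟦ a ⟧)
      rearrange true true true x = +-identityʳ _
      rearrange true true false x = refl

    S = μ (λ y → ⟦ GX y ⟧ * blueI y)

    -- The three terms on the left are used separately: the first bounds the blue incidences, the
    -- second gives `κ ≤ n` and the density of `G` on the atom, the third gives the size of the
    -- atom.
    main : 8 * r * S + κ * ∣ X ∣ + w ≤ n * ∣ GX ∣
    main = begin
      8 * r * S + κ * ∣ X ∣ + w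
        ≡⟨ cong (_+ w) (cong₂ _+_ (μ-* (8 * r) _) (μ-* κ _)) ⟨
      μ (λ y → 8 * r * (⟦ GX y ⟧ * blueI y)) + μ (λ y → κ * ⟦ X y ⟧) + w
        ≡⟨ cong (_+ w) (μ-+ _ _) ⟨
      μ (λ y → 8 * r * (⟦ GX y ⟧ * blueI y) + κ * ⟦ X y ⟧) + w
        ≡⟨ cong (_+ w) (μ-cong λ (b , c) → ψ-point b c) ⟨
      μ (λ (b , c) → ⟦ X (b , c) ⟧ * ψ b c) + w
        ≡⟨ cong (_+ w) (∑∈-box XB XC ψ) ⟨
      ∑∈ XC (λ c → ∑∈ XB (λ b → ψ b c)) + w
        ≤⟨ excess ⟩
      ∑∈ XC (λ c → ∑∈ XB (λ b → φ b c))
        ≡⟨ ∑∈-box XB XC φ ⟩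
      μ (λ (b , c) → ⟦ X (b , c) ⟧ * φ b c)
        ≡⟨ μ-cong (λ (b , c) → φ-point b c) ⟩
      μ (λ y → n * ⟦ GX y ⟧)
        ≡⟨ μ-* n _ ⟩
      n * ∣ GX ∣ ∎
      where open ≤-Reasoning

    ∣X∣ : ∣ X ∣ ≡ count XB * count XC
    ∣X∣ = ∑∑-count XB XC

    GX≤X : ∣ GX ∣ ≤ ∣ X ∣
    GX≤X = μ-mono λ (b , c) → ∧-≤ (X (b , c)) (G b c)
      where
      ∧-≤ : ∀ a b → ⟦ a ∧ b ⟧ ≤ ⟦ a ⟧
      ∧-≤ true b = ⟦⟧≤1 b
      ∧-≤ false b = z≤n

    w≤ : w ≤ n * ∣ GX ∣
    w≤ = ≤-trans (m≤n+m w _) main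

    1≤4^m : 1 ≤ 4 ^ m
    1≤4^m = m^n>0 4 m

    1≤M : 1 ≤ M
    1≤M = subst (1 ≤_) (sym M≡) (*-mono-≤ 1≤4^m 1≤W)

    1≤n∣GX∣ : 1 ≤ n * ∣ GX ∣
    1≤n∣GX∣ = ≤-trans (*-mono-≤ 1≤4^m (*-mono-≤ 1≤W 1≤W)) w≤

    1≤∣GX∣ : 1 ≤ ∣ GX ∣
    1≤∣GX∣ = n≢0⇒n>0 λ e → contradiction (subst (1 ≤_) (trans (cong (n *_) e) (*-zeroʳ n)) 1≤n∣GX∣) λ ()

    1≤n : 1 ≤ n
    1≤n = n≢0⇒n>0 λ e → contradiction (subst (1 ≤_) (cong (_* ∣ GX ∣) e) 1≤n∣GX∣) λ ()

    κX≤ : κ * ∣ X ∣ ≤ n * ∣ GX ∣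
    κX≤ = ≤-trans (≤-trans (m≤n+m _ (8 * r * S)) (m≤m+n _ w)) main

    κ≤n : κ ≤ n
    κ≤n = *-cancelʳ-≤ κ n ∣ GX ∣ {{>-nonZero 1≤∣GX∣}} (≤-trans (*-monoʳ-≤ κ GX≤X) κX≤)

    1≤κ : 1 ≤ κ
    1≤κ = *-mono-≤ {1} {4} (s≤s z≤n) 1≤rs

    n≤m : n ≤ m
    n≤m = count≤ I

    -- Here `m` equals `4 * Θ * κ` and bounds `n`, so `κ` cancels.
    X≤GX : ∣ X ∣ ≤ 4 * Θ * ∣ GX ∣
    X≤GX = *-cancelˡ-≤ κ {{>-nonZero 1≤κ}} (begin
      κ * ∣ X ∣ ≤⟨ κX≤ ⟩
      n * ∣ GX ∣ ≤⟨ *-monoˡ-≤ ∣ GX ∣ n≤m ⟩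
      m * ∣ GX ∣ ≡⟨ cong (_* ∣ GX ∣) m≡ ⟩
      16 * Θ * (r * s) * ∣ GX ∣ ≡⟨ ring Θ (r * s) ∣ GX ∣ ⟩
      κ * (4 * Θ * ∣ GX ∣) ∎)
      where
      open ≤-Reasoning
      ring : ∀ a b c → 16 * a * b * c ≡ 4 * b * (4 * a * c)
      ring = solve-∀

    MW≤ : M * W ≤ m * (count XB * count XC)
    MW≤ = begin
      M * W ≡⟨ cong (_* W) M≡ ⟩
      4 ^ m * W * W ≡⟨ *-assoc (4 ^ m) W W ⟩
      w ≤⟨ w≤ ⟩
      n * ∣ GX ∣ ≤⟨ *-mono-≤ n≤m GX≤X ⟩
      m * ∣ X ∣ ≡⟨ cong (m *_) ∣X∣ ⟩
      m * (count XB * count XC) ∎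
      where open ≤-Reasoning

    W≤XB : W ≤ m * count XB
    W≤XB = *-cancelˡ-≤ M {{>-nonZero 1≤M}} (begin
      M * W ≤⟨ MW≤ ⟩
      m * (count XB * count XC) ≤⟨ *-monoʳ-≤ m (*-monoʳ-≤ (count XB) (count≤ XC)) ⟩
      m * (count XB * M) ≡⟨ ring m (count XB) M ⟩
      M * (m * count XB) ∎)
      where
      open ≤-Reasoning
      ring : ∀ a b c → a * (b * c) ≡ c * (a * b)
      ring = solve-∀

    W≤XC : W ≤ m * count XC
    W≤XC = *-cancelˡ-≤ M {{>-nonZero 1≤M}} (begin
      M * W ≤⟨ MW≤ ⟩
      m * (count XB * count XC) ≤⟨ *-monoʳ-≤ m (*-monoˡ-≤ (count XC) (count≤ XB)) ⟩
      m * (M * count XC) ≡⟨ ring m M (count XC) ⟩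
      M * (m * count XC) ∎)
      where
      open ≤-Reasoning
      ring : ∀ a b c → a * (b * c) ≡ b * (a * c)
      ring = solve-∀

    1≤m : 1 ≤ m
    1≤m = ≤-trans 1≤n n≤m

    -- `1 / T` is the density left after the first round: 4Θ is lost to the density of `G`, 2 to
    -- discarding pairs with much blue, `Λ` to the selection. In `K`, the factor `2 * T` pays for
    -- restricting to columns of large degree, `(4 * T) ^ s` for selecting `s` rows, and `s` is the
    -- number of columns wanted.
    T = 8 * Θ * Λ
    K = 2 * T * ((4 * T) ^ s * s)

    1≤T : 1 ≤ T
    1≤T = *-mono-≤ (*-mono-≤ {1} {8} (s≤s z≤n) 1≤Θ) 1≤Λ

    K≤XB : K ≤ count XB
    K≤XB = *-cancelˡ-≤ m {{>-nonZero 1≤m}} (≤-trans W-large W≤XB)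

    K≤XC : K ≤ count XC
    K≤XC = *-cancelˡ-≤ m {{>-nonZero 1≤m}} (≤-trans W-large W≤XC)

    Y₀ : Pair → Bool
    Y₀ y = GX y ∧ (4 * r * blueI y ≤ᵇ n)

    Y₀-point : ∀ y → n * ⟦ GX y ⟧ ≤ n * ⟦ Y₀ y ⟧ + 4 * r * (⟦ GX y ⟧ * blueI y)
    Y₀-point y with GX y | 4 * r * blueI y ≤ᵇ n in eq
    ... | false | _ = ≤-trans (≤-reflexive (*-zeroʳ n)) z≤n
    ... | true | true = m≤m+n _ _
    ... | true | false = begin
      n * 1 ≡⟨ *-identityʳ n ⟩
      n ≤⟨ <⇒≤ (≰⇒> λ le → case trans (sym eq) (T⇒≡ (≤⇒≤ᵇ le)) of λ ()) ⟩
      4 * r * blueI y ≡⟨ cong (4 * r *_) (+-identityʳ (blueI y)) ⟨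
      4 * r * (1 * blueI y) ≤⟨ m≤n+m _ _ ⟩
      n * 0 + 4 * r * (1 * blueI y) ∎
      where
      open ≤-Reasoning

    -- Markov's inequality: `S` is at most n/(8r) times the number of pairs in `GX`, so at most half
    -- of them are blue for more than n/(4r) indices.
    GX≤Y₀ : ∣ GX ∣ ≤ 2 * ∣ Y₀ ∣
    GX≤Y₀ = *-cancelˡ-≤ n {{>-nonZero 1≤n}} (+-cancelʳ-≤ (n * ∣ GX ∣) _ _ (begin
      n * ∣ GX ∣ + n * ∣ GX ∣ ≡⟨ ring₁ (n * ∣ GX ∣) ⟩
      2 * (n * ∣ GX ∣) ≡⟨ cong (2 *_) (μ-* n _) ⟨
      2 * μ (λ y → n * ⟦ GX y ⟧) ≤⟨ *-monoʳ-≤ 2 (μ-mono Y₀-point) ⟩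
      2 * μ (λ y → n * ⟦ Y₀ y ⟧ + 4 * r * (⟦ GX y ⟧ * blueI y))
        ≡⟨ cong (2 *_) (trans (μ-+ _ _) (cong₂ _+_ (μ-* n _) (μ-* (4 * r) _))) ⟩
      2 * (n * ∣ Y₀ ∣ + 4 * r * S) ≡⟨ ring₂ n ∣ Y₀ ∣ r S ⟩
      n * (2 * ∣ Y₀ ∣) + 8 * r * S
        ≤⟨ +-monoʳ-≤ (n * (2 * ∣ Y₀ ∣)) (≤-trans (≤-trans (m≤m+n (8 * r * S) _) (m≤m+n _ w)) main) ⟩
      n * (2 * ∣ Y₀ ∣) + n * ∣ GX ∣ ∎))
      where
      open ≤-Reasoning
      ring₁ : ∀ a → a + a ≡ 2 * a
      ring₁ = solve-∀
      ring₂ : ∀ n y r s → 2 * (n * y + 4 * r * s) ≡ n * (2 * y) + 8 * r * s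
      ring₂ = solve-∀

    1≤∣Y₀∣ : 1 ≤ ∣ Y₀ ∣
    1≤∣Y₀∣ = n≢0⇒n>0 λ e → contradiction (≤-trans 1≤∣GX∣ (subst (λ z → ∣ GX ∣ ≤ 2 * z) e GX≤Y₀)) λ ()

    I-split : ∀ b c → n ≡ count (λ i → I i ∧ red i b c) + blueI (b , c)
    I-split b c = trans (∑-cong λ i → ⟦⟧-split (I i) (red i b c)) (∑-+ _ _)

    -- The fraction `ρ / (2r)` is 1 - 1/(2r). A pair of `Y₀` is blue for at most n/(4r) indices, and
    -- `κ ≤ n` says that `s` is at most n/(4r), so the two losses together are at most n/(2r).
    rich₁ : ∀ y → Y₀ y ≡ true →
      ρ * n + 2 * r * s ≤ 2 * r * count (λ i → I i ∧ red i (proj₁ y) (proj₂ y))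
    rich₁ (b , c) e = +-cancelʳ-≤ (n + 2 * r * bq) _ _ (begin
      ρ * n + 2 * r * s + (n + 2 * r * bq) ≡⟨ ring₁ ρ n (2 * r * s) (2 * r * bq) ⟩
      suc ρ * n + (2 * r * s + 2 * r * bq) ≤⟨ +-mono-≤ (≤-reflexive (cong (_* n) 1+ρ≡2r)) half ⟩
      2 * r * n + n ≡⟨ cong (λ z → 2 * r * z + n) (I-split b c) ⟩
      2 * r * (a + bq) + n ≡⟨ ring₂ r a bq n ⟩
      2 * r * a + (n + 2 * r * bq) ∎)
      where
      open ≤-Reasoning
      bq = blueI (b , c)
      a = count (λ i → I i ∧ red i b c)
      half : 2 * r * s + 2 * r * bq ≤ n
      half = *-cancelˡ-≤ 2 (begin
        2 * (2 * r * s + 2 * r * bq) ≡⟨ ring r s bq ⟩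
        κ + 4 * r * bq ≤⟨ +-mono-≤ κ≤n (≤ᵇ⇒≤ _ _ (subst Bool.T (sym (proj₂ (∧-true {GX (b , c)} e))) _)) ⟩
        n + n ≡⟨ cong (n +_) (+-identityʳ n) ⟨
        2 * n ∎)
        where
        ring : ∀ r s b → 2 * (2 * r * s + 2 * r * b) ≡ 4 * (r * s) + 4 * r * b
        ring = solve-∀
      ring₁ : ∀ p n x y → p * n + x + (n + y) ≡ (1 + p) * n + (x + y)
      ring₁ = solve-∀
      ring₂ : ∀ r a b n → 2 * r * (a + b) + n ≡ 2 * r * a + (n + 2 * r * b)
      ring₂ = solve-∀

    1≤2r : 1 ≤ 2 * r
    1≤2r = *-mono-≤ {1} {2} (s≤s z≤n) 1≤r

    module Sel₁ = Greedy (∑∑-summation M M) I (λ i y → red i (proj₁ y) (proj₂ y)) Y₀ ρ (2 * r) s 1≤2r rich₁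

    module Thin (stage : Sel₁.Stage s) where
      open Sel₁.Stage stage using (J; Y)
      module St₁ = Sel₁.Stage stage

      1≤ρ : 1 ≤ ρ
      1≤ρ = ≤-pred (subst (2 ≤_) (sym 1+ρ≡2r) (*-monoʳ-≤ 2 1≤r))

      Y₀≤Y : ∣ Y₀ ∣ ≤ Λ * ∣ Y ∣
      Y₀≤Y = *-cancelʳ-≤ _ _ (ρ ^ s) {{m^n≢0 ρ s {{>-nonZero 1≤ρ}}}} (begin
        ∣ Y₀ ∣ * ρ ^ s ≤⟨ St₁.large ⟩
        ∣ Y ∣ * (2 * r) ^ s ≤⟨ *-monoʳ-≤ ∣ Y ∣ Λ-large ⟩
        ∣ Y ∣ * (Λ * ρ ^ s) ≡⟨ ring ∣ Y ∣ Λ (ρ ^ s) ⟩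
        Λ * ∣ Y ∣ * ρ ^ s ∎)
        where
        open ≤-Reasoning
        ring : ∀ a b c → a * (b * c) ≡ b * a * c
        ring = solve-∀

      X≤Y : ∣ X ∣ ≤ T * ∣ Y ∣
      X≤Y = begin
        ∣ X ∣ ≤⟨ X≤GX ⟩
        4 * Θ * ∣ GX ∣ ≤⟨ *-monoʳ-≤ (4 * Θ) (≤-trans GX≤Y₀ (*-monoʳ-≤ 2 Y₀≤Y)) ⟩
        4 * Θ * (2 * (Λ * ∣ Y ∣)) ≡⟨ ring Θ Λ ∣ Y ∣ ⟩
        T * ∣ Y ∣ ∎
        where
        open ≤-Reasoning
        ring : ∀ a b c → 4 * a * (2 * (b * c)) ≡ 8 * a * b * c
        ring = solve-∀

      Y⊆X : ∀ b c → Y (b , c) ≡ true → XB b ≡ true × XC c ≡ true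
      Y⊆X b c e = ∧-true (proj₁ (∧-true (proj₁ (∧-true (St₁.Y⊆Y₀ (b , c) e)))))

      x = count XB

      1≤K : 1 ≤ K
      1≤K = *-mono-≤ (*-mono-≤ {1} {2} (s≤s z≤n) 1≤T)
        (*-mono-≤ (m^n>0 (4 * T) {{>-nonZero (*-mono-≤ {1} {4} (s≤s z≤n) 1≤T)}} s) 1≤s)

      1≤x : 1 ≤ x
      1≤x = ≤-trans 1≤K K≤XB

      deg : Fin M → ℕ
      deg c = count (λ b → XB b ∧ Y (b , c))

      Z₀ : Fin M → Bool
      Z₀ c = XC c ∧ (x ≤ᵇ 2 * T * deg c)

      Y≤deg : ∀ c → count (λ b → Y (b , c)) ≤ deg c
      Y≤deg c = ∑-mono λ b → point b (Y (b , c)) refl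
        where
        point : ∀ b y → Y (b , c) ≡ y → ⟦ y ⟧ ≤ ⟦ XB b ∧ y ⟧
        point b false _ = z≤n
        point b true e rewrite proj₁ (Y⊆X b c e) = ≤-refl

      Y≤x : ∀ c → count (λ b → Y (b , c)) ≤ ⟦ XC c ⟧ * x
      Y≤x c = ≤-trans (∑-mono λ b → point b (Y (b , c)) refl) (≤-reflexive (∑-* ⟦ XC c ⟧ _))
        where
        point : ∀ b y → Y (b , c) ≡ y → ⟦ y ⟧ ≤ ⟦ XC c ⟧ * ⟦ XB b ⟧
        point b false _ = z≤n
        point b true e rewrite proj₁ (Y⊆X b c e) | proj₂ (Y⊆X b c e) = ≤-refl

      Z₀-point : ∀ c → 2 * T * count (λ b → Y (b , c)) ≤ 2 * T * x * ⟦ Z₀ c ⟧ + x * ⟦ XC c ⟧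
      Z₀-point c with XC c | x ≤ᵇ 2 * T * deg c in eq | Y≤x c
      ... | false | _ | le = ≤-trans (*-monoʳ-≤ (2 * T) le) (≤-trans (≤-reflexive (*-zeroʳ (2 * T))) z≤n)
      ... | true | true | le = ≤-trans (*-monoʳ-≤ (2 * T) le)
              (≤-trans (≤-reflexive (ring (2 * T) x)) (m≤m+n _ _))
        where
        ring : ∀ a b → a * (b + 0) ≡ a * b * 1
        ring = solve-∀
      ... | true | false | _ = begin
        2 * T * count (λ b → Y (b , c)) ≤⟨ *-monoʳ-≤ (2 * T) (Y≤deg c) ⟩
        2 * T * deg c ≤⟨ <⇒≤ (≰⇒> λ le → case trans (sym eq) (T⇒≡ (≤⇒≤ᵇ le)) of λ ()) ⟩
        x ≡⟨ *-identityʳ x ⟨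
        x * 1 ≤⟨ m≤n+m _ _ ⟩
        2 * T * x * 0 + x * 1 ∎
        where
        open ≤-Reasoning

      -- Columns outside `Z₀` hold fewer than x/(2T) pairs each, in total at most half of `Y` by
      -- `X≤Y`. The other half lies in columns of `Z₀`, with at most `x` pairs each.
      XC≤Z₀ : count XC ≤ 2 * T * count Z₀
      XC≤Z₀ = *-cancelˡ-≤ x {{>-nonZero 1≤x}} (begin
        x * count XC ≡⟨ ∣X∣ ⟨
        ∣ X ∣ ≤⟨ X≤Y ⟩
        T * ∣ Y ∣ ≤⟨ +-cancelʳ-≤ (T * ∣ Y ∣) _ _ doubled ⟩
        2 * T * x * count Z₀ ≡⟨ ring (2 * T) x (count Z₀) ⟩
        x * (2 * T * count Z₀) ∎)
        where
        open ≤-Reasoning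
        ring : ∀ a b c → a * b * c ≡ b * (a * c)
        ring = solve-∀
        ring′ : ∀ t y → t * y + t * y ≡ 2 * t * y
        ring′ = solve-∀
        doubled : T * ∣ Y ∣ + T * ∣ Y ∣ ≤ 2 * T * x * count Z₀ + T * ∣ Y ∣
        doubled = begin
          T * ∣ Y ∣ + T * ∣ Y ∣ ≡⟨ ring′ T ∣ Y ∣ ⟩
          2 * T * ∣ Y ∣ ≡⟨ cong (2 * T *_) (∑-swap _) ⟩
          2 * T * ∑ (λ c → count (λ b → Y (b , c))) ≡⟨ ∑-* (2 * T) _ ⟨
          ∑ (λ c → 2 * T * count (λ b → Y (b , c))) ≤⟨ ∑-mono Z₀-point ⟩
          ∑ (λ c → 2 * T * x * ⟦ Z₀ c ⟧ + x * ⟦ XC c ⟧) ≡⟨ ∑-+ _ _ ⟩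
          ∑ (λ c → 2 * T * x * ⟦ Z₀ c ⟧) + ∑ (λ c → x * ⟦ XC c ⟧) ≡⟨ cong₂ _+_ (∑-* (2 * T * x) _) (∑-* x _) ⟩
          2 * T * x * count Z₀ + x * count XC ≡⟨ cong (2 * T * x * count Z₀ +_) ∣X∣ ⟨
          2 * T * x * count Z₀ + ∣ X ∣ ≤⟨ +-monoʳ-≤ (2 * T * x * count Z₀) X≤Y ⟩
          2 * T * x * count Z₀ + T * ∣ Y ∣ ∎

      4≤4T : 4 ≤ 4 * T
      4≤4T = *-monoʳ-≤ 4 1≤T

      4Ts≤x : 4 * T * s ≤ x
      4Ts≤x = begin
        4 * T * s ≡⟨ ring T s ⟩
        2 * T * (2 * s) ≤⟨ *-monoʳ-≤ (2 * T) (*-monoˡ-≤ s (begin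
          2 ≤⟨ s≤s (s≤s z≤n) ⟩
          4 ≤⟨ 4≤4T ⟩
          4 * T ≡⟨ ^-identityʳ (4 * T) ⟨
          (4 * T) ^ 1 ≤⟨ ^-monoʳ-≤ (4 * T) {{>-nonZero (≤-trans (s≤s z≤n) 4≤4T)}} 1≤s ⟩
          (4 * T) ^ s ∎)) ⟩
        K ≤⟨ K≤XB ⟩
        x ∎
        where
        open ≤-Reasoning
        ring : ∀ t s → 4 * t * s ≡ 2 * t * (2 * s)
        ring = solve-∀

      -- The degree x/(2T) is twice x/(4T), and the second x/(4T) is at least `s`.
      rich₂ : ∀ c → Z₀ c ≡ true → 1 * count XB + 4 * T * s ≤ 4 * T * count (λ b → XB b ∧ Y (b , c))
      rich₂ c e = begin
        1 * x + 4 * T * s ≤⟨ +-monoʳ-≤ (1 * x) 4Ts≤x ⟩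
        1 * x + x ≡⟨ ring x ⟩
        2 * x ≤⟨ *-monoʳ-≤ 2 (≤ᵇ⇒≤ x (2 * T * deg c) (subst Bool.T (sym (proj₂ (∧-true {XC c} e))) _)) ⟩
        2 * (2 * T * deg c) ≡⟨ ring′ T (deg c) ⟩
        4 * T * deg c ∎
        where
        open ≤-Reasoning
        ring : ∀ x → 1 * x + x ≡ 2 * x
        ring = solve-∀
        ring′ : ∀ t d → 2 * (2 * t * d) ≡ 4 * t * d
        ring′ = solve-∀

      1≤Z₀ : 1 ≤ count Z₀
      1≤Z₀ = n≢0⇒n>0 λ e → contradiction
        (≤-trans 1≤K (≤-trans K≤XC (subst (count XC ≤_) (trans (cong (2 * T *_) e) (*-zeroʳ (2 * T))) XC≤Z₀))) λ ()

      -- A greedy form of the Kővári-Sós-Turán argument: rows are selected, and the columns adjacent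
      -- to all of them survive.
      module Sel₂ = Greedy (∑-summation M) XB (λ b c → Y (b , c)) Z₀ 1 (4 * T) s
        (≤-trans (s≤s z≤n) 4≤4T) rich₂

      module Block (stage′ : Sel₂.Stage s) where
        module St₂ = Sel₂.Stage stage′

        s≤Z : s ≤ count St₂.Y
        s≤Z = *-cancelˡ-≤ ((4 * T) ^ s) {{m^n≢0 (4 * T) s {{>-nonZero (≤-trans (s≤s z≤n) 4≤4T)}}}}
          (*-cancelˡ-≤ (2 * T) {{>-nonZero (*-mono-≤ {1} {2} (s≤s z≤n) 1≤T)}} (begin
            K ≤⟨ K≤XC ⟩
            count XC ≤⟨ XC≤Z₀ ⟩
            2 * T * count Z₀ ≡⟨ cong (2 * T *_) (trans (cong (count Z₀ *_) (^-zeroˡ s)) (*-identityʳ _)) ⟨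
            2 * T * (count Z₀ * 1 ^ s) ≤⟨ *-monoʳ-≤ (2 * T) St₂.large ⟩
            2 * T * (count St₂.Y * (4 * T) ^ s) ≡⟨ cong (2 * T *_) (*-comm (count St₂.Y) _) ⟩
            2 * T * ((4 * T) ^ s * count St₂.Y) ∎))
          where open ≤-Reasoning

        block : RedBlock red s
        block = record
          { A′ = J ; B′ = St₂.J ; C′ = St₂.Y
          ; s≤A = ≤-reflexive (sym St₁.∣J∣) ; s≤B = ≤-reflexive (sym St₂.∣J∣) ; s≤C = s≤Z
          ; allRed = λ i b c i∈ b∈ c∈ → St₁.complete i (b , c) i∈ (St₂.complete b c b∈ c∈) }

      thinBlock : RedBlock red s
      thinBlock = Block.block (Sel₂.select 1≤Z₀)

    refinedBlock : RedBlock red s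
    refinedBlock = Thin.thinBlock (Sel₁.select 1≤∣Y₀∣)

  redBlock : RedBlock red s
  redBlock = Refine.refinedBlock atomBox

-- Sums over initial segments, degrees and codegrees.

≡⇒T : ∀ {b} → b ≡ true → Bool.T b
≡⇒T refl = _

<ᵇ-false : ∀ {m n} → (m <ᵇ n) ≡ false → n ≤ m
<ᵇ-false {m} {n} eq = ≮⇒≥ λ lt → case trans (sym eq) (T⇒≡ (<⇒<ᵇ lt)) of λ ()

opaque
  unfolding ∑

  sum-allFin : ∀ {n} (f : Fin n → ℕ) → sum (map f (allFin n)) ≡ ∑ f
  sum-allFin {n} f = trans (cong sum (map-tabulate id f)) (go f)
    where
    go : ∀ {n} (f : Fin n → ℕ) → sum (List.tabulate f) ≡ ∑ f
    go {zero} f = refl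
    go {suc n} f = cong (f zero +_) (go (f ∘ suc))

before : ∀ {t} → ℕ → (Fin t → ℕ) → ℕ
before k φ = ∑ λ x → ⟦ toℕ x <ᵇ k ⟧ * φ x

opaque
  unfolding ∑

  before-suc : ∀ {t} (u : Fin t) φ → before (suc (toℕ u)) φ ≡ before (toℕ u) φ + φ u
  before-suc {suc t} zero φ = begin
    φ zero + 0 + before 0 (φ ∘ suc) ≡⟨ ring (φ zero) (before 0 (φ ∘ suc)) ⟩
    before 0 (φ ∘ suc) + φ zero ∎
    where
    open ≡-Reasoning
    ring : ∀ a b → a + 0 + b ≡ b + a
    ring = solve-∀
  before-suc (suc u) φ = trans (cong (φ zero + 0 +_) (before-suc u (φ ∘ suc)))
                               (sym (+-assoc (φ zero + 0) _ _))

before-0 : ∀ {t} (φ : Fin t → ℕ) → before 0 φ ≡ 0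
before-0 {t} φ = trans (∑-const t 0) (*-zeroʳ t)

before≤ : ∀ {t} k (φ : Fin t → ℕ) → before k φ ≤ ∑ φ
before≤ k φ = ∑-mono λ x → ≤-trans (*-monoˡ-≤ (φ x) (⟦⟧≤1 (toℕ x <ᵇ k))) (≤-reflexive (+-identityʳ _))

module Degrees {t} (H : Hypergraph3 t) {d : ℕ} (deg≤d : MaxDegreeAtMost H d) where

  edge : Fin t → Fin t → Fin t → Bool
  edge i j k = increasing i j k ∧ E H i j k

  edge-< : ∀ {i j k} → edge i j k ≡ true → toℕ i < toℕ j × toℕ j < toℕ k
  edge-< {i} {j} {k} e =
    let inc = ∧-true {toℕ i <ᵇ toℕ j} (proj₁ (∧-true {increasing i j k} e))
    in <ᵇ⇒< _ _ (≡⇒T (proj₁ inc)) , <ᵇ⇒< _ _ (≡⇒T (proj₂ inc))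

  private
    incident : Fin t → Fin t → Fin t → Fin t → ℕ
    incident v i j k = ⟦ increasing i j k ∧ E H i j k ∧ contains v i j k ⟧

    degree-∑ : ∀ v → degree H v ≡ ∑ λ i → ∑ λ j → ∑ λ k → incident v i j k
    degree-∑ v = trans (sum-allFin _) (∑-cong λ i →
      trans (sum-allFin _) (∑-cong λ j → sum-allFin (incident v i j)))

    incident≤d : ∀ v → ∑ (λ i → ∑ λ j → ∑ λ k → incident v i j k) ≤ d
    incident≤d v = subst (_≤ d) (degree-∑ v) (deg≤d v)

    edge≤incident : ∀ v i j k → contains v i j k ≡ true → ⟦ edge i j k ⟧ ≤ incident v i j k
    edge≤incident v i j k e rewrite e with increasing i j k | E H i j k
    ... | true | true = ≤-refl
    ... | true | false = z≤n
    ... | false | _ = z≤n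

    ≡ᵇ-self : ∀ n → (n ≡ᵇ n) ≡ true
    ≡ᵇ-self n = T⇒≡ (≡⇒≡ᵇ n n refl)

    contains₁ : ∀ (v j k : Fin t) → contains v v j k ≡ true
    contains₁ v j k rewrite ≡ᵇ-self (toℕ v) = refl

    contains₂ : ∀ (v i k : Fin t) → contains v i v k ≡ true
    contains₂ v i k rewrite ≡ᵇ-self (toℕ v) = ∨-zeroʳ (toℕ i ≡ᵇ toℕ v)

    contains₃ : ∀ (v i j : Fin t) → contains v i j v ≡ true
    contains₃ v i j rewrite ≡ᵇ-self (toℕ v) | ∨-zeroʳ (toℕ j ≡ᵇ toℕ v) = ∨-zeroʳ (toℕ i ≡ᵇ toℕ v)

  -- Edges at a vertex are counted by its position in them. The first position bounds the links to
  -- be kept dense, the middle one the codegrees, the last one the number of cuts of a candidate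
  -- set.
  degree-first : ∀ u → ∑ (λ v → ∑ λ w → ⟦ edge u v w ⟧) ≤ d
  degree-first u = ≤-trans
    (∑-mono λ v → ∑-mono λ w → edge≤incident u u v w (contains₁ u v w))
    (≤-trans (term≤∑ (λ i → ∑ λ v → ∑ λ w → incident u i v w) u) (incident≤d u))

  degree-middle : ∀ u → ∑ (λ x → ∑ λ v → ⟦ edge x u v ⟧) ≤ d
  degree-middle u = ≤-trans
    (∑-mono λ x → ≤-trans (∑-mono λ v → edge≤incident u x u v (contains₂ u x v))
                          (term≤∑ (λ j → ∑ λ v → incident u x j v) u))
    (incident≤d u)

  degree-last : ∀ v → ∑ (λ x → ∑ λ y → ⟦ edge x y v ⟧) ≤ d
  degree-last v = ≤-trans
    (∑-mono λ x → ∑-mono λ y → ≤-trans (edge≤incident v x y v (contains₃ v x y))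
                                       (term≤∑ (λ k → incident v x y k) v))
    (incident≤d v)

  codegree : ℕ → Fin t → Fin t → ℕ
  codegree k v w = before k λ x → ⟦ edge x v w ⟧

  codegree≤d : ∀ k v w → codegree k v w ≤ d
  codegree≤d k v w = ≤-trans (before≤ k _) (≤-trans
    (∑-mono λ x → term≤∑ (λ w → ⟦ edge x v w ⟧) w) (degree-middle v))

  -- The number of edges with last vertex `v` whose two other vertices are among the first `k`; it
  -- is the exponent of the loss of the candidate set of `v`.
  cuts : ℕ → Fin t → ℕ
  cuts k v = before k λ y → codegree (toℕ y) y v

  cuts≤d : ∀ k v → cuts k v ≤ d
  cuts≤d k v = ≤-trans (before≤ k _) (≤-trans (∑-mono λ y → before≤ (toℕ y) _)
    (≤-trans (≤-reflexive (∑-swap _)) (degree-last v)))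

-- Density on all large boxes.

module Density (M M₁ : ℕ) (1≤M₁ : 1 ≤ M₁) where

  size : Subset M → ℕ
  size B = count (lookup B)

  -- `Γ` is an inverse density. Boxes are given by `Subset`, so that a search through all of them
  -- decides whether a sparse one exists.
  Sparse : ℕ → (Fin M → Fin M → Bool) → Subset M → Subset M → Set
  Sparse Γ G B C = M₁ ≤ size B × M₁ ≤ size C × Γ * inBox (lookup B) (lookup C) G < size B * size C

  sparse? : ∀ Γ G → Dec (∃ λ B → ∃ λ C → Sparse Γ G B C)
  sparse? Γ G = anySubset? λ B → anySubset? λ C →
    (M₁ ≤? size B) ×-dec (M₁ ≤? size C) ×-dec
    (Γ * inBox (lookup B) (lookup C) G <? size B * size C)

  Dense : ℕ → (Fin M → Fin M → Bool) → Set
  Dense Γ G = ∀ B C → M₁ ≤ size B → M₁ ≤ size C →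
    size B * size C ≤ Γ * inBox (lookup B) (lookup C) G

  ¬sparse⇒dense : ∀ {Γ G} → ¬ (∃ λ B → ∃ λ C → Sparse Γ G B C) → Dense Γ G
  ¬sparse⇒dense ¬sparse B C b c = ≮⇒≥ λ lt → ¬sparse (B , C , b , c , lt)

  complete-dense : Dense 1 (λ _ _ → true)
  complete-dense B C _ _ = ≤-reflexive (sym (trans (+-identityʳ _)
    (trans (∑-cong λ b → ∑-cong λ c → trans (cong (⟦ lookup B b ⟧ *_) (*-identityʳ _))
                                             (sym (⟦⟧-∧ (lookup B b) (lookup C c))))
           (∑∑-count (lookup B) (lookup C)))))

  lowDegree : ℕ → (Fin M → Bool) → (Fin M → Fin M → Bool) → Fin M → Bool
  lowDegree Γ S G p = Γ * count (λ q → S q ∧ G p q) <ᵇ count S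

  -- If there were `M₁` points of low degree, they would form with `S` a large box whose edge count
  -- is too small for `Dense`.
  few-lowDegree : ∀ {Γ G} S → Dense Γ G → M₁ ≤ count S → count (lowDegree Γ S G) < M₁
  few-lowDegree {Γ} {G} S dense large = ≰⇒> λ many → <-irrefl refl (begin-strict
    ℓ * σ ≡⟨ cong₂ _*_ size-L size-S ⟨
    size L * size S′ ≤⟨ dense L S′ (subst (M₁ ≤_) (sym size-L) many) (subst (M₁ ≤_) (sym size-S) large) ⟩
    Γ * inBox (lookup L) (lookup S′) G ≡⟨ cong (Γ *_) box ⟩
    Γ * ∑ (λ p → ⟦ low p ⟧ * deg p) ≡⟨ ∑-* Γ _ ⟨
    ∑ (λ p → Γ * (⟦ low p ⟧ * deg p)) <⟨ m<m+n _ (≤-trans 1≤M₁ many) ⟩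
    ∑ (λ p → Γ * (⟦ low p ⟧ * deg p)) + ℓ ≡⟨ ∑-+ _ _ ⟨
    ∑ (λ p → Γ * (⟦ low p ⟧ * deg p) + ⟦ low p ⟧) ≤⟨ ∑-mono point ⟩
    ∑ (λ p → σ * ⟦ low p ⟧) ≡⟨ ∑-* σ _ ⟩
    σ * ℓ ≡⟨ *-comm σ ℓ ⟩
    ℓ * σ ∎)
    where
    open ≤-Reasoning
    low = lowDegree Γ S G
    L S′ : Subset M
    L = tabulate low
    S′ = tabulate S
    ℓ = count low
    σ = count S
    deg : Fin M → ℕ
    deg p = count (λ q → S q ∧ G p q)
    size-L : size L ≡ ℓ
    size-L = count-cong (lookup∘tabulate low)
    size-S : size S′ ≡ σ
    size-S = count-cong (lookup∘tabulate S)
    box : inBox (lookup L) (lookup S′) G ≡ ∑ (λ p → ⟦ low p ⟧ * deg p)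
    box = ∑-cong λ p → trans
      (∑-cong λ q → cong₂ _*_ (cong ⟦_⟧ (lookup∘tabulate low p))
        (trans (cong (λ z → ⟦ z ⟧ * ⟦ G p q ⟧) (lookup∘tabulate S q)) (sym (⟦⟧-∧ (S q) (G p q)))))
      (∑-* ⟦ low p ⟧ _)
    point : ∀ p → Γ * (⟦ low p ⟧ * deg p) + ⟦ low p ⟧ ≤ σ * ⟦ low p ⟧
    point p with low p in eq
    ... | false = ≤-reflexive (trans (+-identityʳ _) (trans (*-zeroʳ Γ) (sym (*-zeroʳ σ))))
    ... | true = begin
      Γ * (1 * deg p) + 1 ≡⟨ cong (λ z → Γ * z + 1) (+-identityʳ (deg p)) ⟩
      Γ * deg p + 1 ≡⟨ +-comm _ 1 ⟩
      suc (Γ * deg p) ≤⟨ <ᵇ⇒< _ _ (≡⇒T eq) ⟩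
      σ ≡⟨ *-identityʳ σ ⟨
      σ * 1 ∎

-- Embedding the vertices one by one.

module Embedding {d s r Λ ρ W D P Θ m M₁ M : ℕ} (1≤s : 1 ≤ s) (1≤r : 1 ≤ r) (1≤Λ : 1 ≤ Λ) (1≤W : 1 ≤ W)
  -- `D` is the density loss per edge and fits the blue fraction 1/(16r) of `redBlock`. By `P`, a
  -- candidate set that lost a factor `D ^ d` still has `(2d + 1) * M₁` points, against at most
  -- `2d * M₁` bad ones. By `Θ`, a box with sides at least `M₁ = M / P` and density at least 1 /
  -- `D ^ d` holds `M * M / Θ` pairs.
  (D≡ : D ≡ 16 * r) (P≡ : P ≡ suc (2 * d) * D ^ d) (Θ≡ : Θ ≡ P * P * D ^ d)
  (m≡ : m ≡ 16 * Θ * (r * s)) (M₁≡ : M₁ ≡ 4 ^ m * W) (M≡ : M ≡ P * M₁)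
  (1+ρ≡2r : suc ρ ≡ 2 * r) (Λ-large : (2 * r) ^ s ≤ Λ * ρ ^ s)
  (W-large : m * (2 * (8 * Θ * Λ) * ((4 * (8 * Θ * Λ)) ^ s * s)) ≤ W)
  where

  1≤D : 1 ≤ D
  1≤D = subst (1 ≤_) (sym D≡) (*-mono-≤ {1} {16} (s≤s z≤n) 1≤r)

  D^>0 : ∀ n → 1 ≤ D ^ n
  D^>0 n = m^n>0 D {{>-nonZero 1≤D}} n

  1≤P : 1 ≤ P
  1≤P = subst (1 ≤_) (sym P≡) (*-mono-≤ {1} {suc (2 * d)} (s≤s z≤n) (D^>0 d))

  1≤Θ : 1 ≤ Θ
  1≤Θ = subst (1 ≤_) (sym Θ≡) (*-mono-≤ (*-mono-≤ 1≤P 1≤P) (D^>0 d))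

  1≤M₁ : 1 ≤ M₁
  1≤M₁ = subst (1 ≤_) (sym M₁≡) (*-mono-≤ (m^n>0 4 m) 1≤W)

  1≤M : 1 ≤ M
  1≤M = subst (1 ≤_) (sym M≡) (*-mono-≤ 1≤P 1≤M₁)

  n≤4^n : ∀ n → n ≤ 4 ^ n
  n≤4^n zero = z≤n
  n≤4^n (suc n) = begin
    1 + n ≤⟨ +-mono-≤ (m^n>0 4 n) (n≤4^n n) ⟩
    4 ^ n + 4 ^ n ≤⟨ +-monoʳ-≤ (4 ^ n) (m≤m+n _ _) ⟩
    4 ^ suc n ∎
    where open ≤-Reasoning

  m≤M₁ : m ≤ M₁
  m≤M₁ = ≤-trans (n≤4^n m) (≤-trans (m≤m*n (4 ^ m) W {{>-nonZero 1≤W}}) (≤-reflexive (sym M₁≡)))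

  open Density M M₁ 1≤M₁

  module _ {t} (H : Hypergraph3 t) (deg≤d : MaxDegreeAtMost H d) (χ : Colouring (t * M)) where

    open Degrees H deg≤d

    -- `combine i x` is the point `x` of the `i`-th of the `t` intervals of length `M`.
    blue : Fin t → Fin t → Fin t → Fin M → Fin M → Fin M → Bool
    blue i j k x y z = not (χ (combine i x) (combine j y) (combine k z))

    combine-monoʳ-< : ∀ (i : Fin t) {x y : Fin M} → x F.< y → combine i x F.< combine i y
    combine-monoʳ-< i {x} {y} x<y = subst₂ _<_ (sym (toℕ-combine i x)) (sym (toℕ-combine i y))
      (+-monoʳ-< (M * toℕ i) x<y)

    redK : ∀ {u v w} → u F.< v → v F.< w → (a : Fin m → Fin M) → StrictlyIncreasing a →
      RedBlock (λ i b c → χ (combine u (a i)) (combine v b) (combine w c)) s → RedK33 χ s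
    redK {u} {v} {w} u<v v<w a a-inc block =
      (λ i → combine u (a (α i))) , (λ i → combine v (β i)) , (λ i → combine w (γ i)) ,
      (λ i j i<j → combine-monoʳ-< u (a-inc _ _ (α-inc i j i<j))) ,
      (λ i j i<j → combine-monoʳ-< v (β-inc i j i<j)) ,
      (λ i j i<j → combine-monoʳ-< w (γ-inc i j i<j)) ,
      (λ i j → combine-monoˡ-< _ _ u<v) , (λ i j → combine-monoˡ-< _ _ v<w) ,
      λ i j k → allRed (α i) (β j) (γ k) (α∈ i) (β∈ j) (γ∈ k)
      where
      open RedBlock block
      eα = enumerate s A′ s≤A
      eβ = enumerate s B′ s≤B
      eγ = enumerate s C′ s≤C
      α = proj₁ eα
      β = proj₁ eβ
      γ = proj₁ eγ
      α-inc = proj₁ (proj₂ eα)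
      β-inc = proj₁ (proj₂ eβ)
      γ-inc = proj₁ (proj₂ eγ)
      α∈ = proj₂ (proj₂ eα)
      β∈ = proj₂ (proj₂ eβ)
      γ∈ = proj₂ (proj₂ eγ)

    link : Fin t → Fin t → Fin t → (Fin M → Fin M → Bool) → Fin M → Fin M → Fin M → Bool
    link u v w G p b c = G b c ∧ blue u v w p b c

    sparseLink : Fin t → Fin t → Fin t → ℕ → (Fin M → Fin M → Bool) → Fin M → Bool
    sparseLink u v w Γ G p = does (sparse? (D * Γ) (link u v w G p))

    M²≤ : ∀ {x y Γ g} → Γ ≤ D ^ d → M₁ ≤ x → M₁ ≤ y → x * y ≤ Γ * g → M * M ≤ Θ * g
    M²≤ {x} {y} {Γ} {g} Γ≤ x≥ y≥ xy≤ = begin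
      M * M ≡⟨ cong₂ _*_ M≡ M≡ ⟩
      P * M₁ * (P * M₁) ≡⟨ ring P M₁ ⟩
      P * P * (M₁ * M₁) ≤⟨ *-monoʳ-≤ (P * P) (≤-trans (*-mono-≤ x≥ y≥) xy≤) ⟩
      P * P * (Γ * g) ≤⟨ *-monoʳ-≤ (P * P) (*-monoˡ-≤ g Γ≤) ⟩
      P * P * (D ^ d * g) ≡⟨ *-assoc (P * P) (D ^ d) g ⟨
      P * P * D ^ d * g ≡⟨ cong (_* g) Θ≡ ⟨
      Θ * g ∎
      where
      open ≤-Reasoning
      ring : ∀ p a → p * a * (p * a) ≡ p * p * (a * a)
      ring = solve-∀

    -- Among `M₁` points with a sparse link there are `m`, as needed by `redBlock`. Density of `G`
    -- makes it large on each witnessing box, and sparsity of the link by a further factor `D` makes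
    -- the blue part at most 1/(16r) of it.
    few-sparseLink : ∀ {u v w} → u F.< v → v F.< w → ∀ {Γ G} → 1 ≤ Γ → Γ ≤ D ^ d → Dense Γ G →
      RedK33 χ s ⊎ count (sparseLink u v w Γ G) < M₁
    few-sparseLink {u} {v} {w} u<v v<w {Γ} {G} 1≤Γ Γ≤ dense
      with count (sparseLink u v w Γ G) <? M₁
    ... | yes few = inj₂ few
    ... | no many = inj₁ (redK u<v v<w a (proj₁ (proj₂ sample))
        -- The parameter `W` becomes `P * W`, since the whole interval has length
        -- `M = 4 ^ m * (P * W)`.
        (redBlock {M} {m} {s} {r} {Θ} {Λ} {P * W} {ρ} 1≤s 1≤r 1≤Θ 1≤Λ m≡ M≡4^mPW 1+ρ≡2r Λ-large
          (*-mono-≤ 1≤P 1≤W) (≤-trans W-large (m≤n*m W P {{>-nonZero 1≤P}}))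
          (λ i b c → χ (combine u (a i)) (combine v b) (combine w c)) G
          (λ i → lookup (B i)) (λ i → lookup (C i)) G-large blue-small))
      where
      sample = enumerate m (sparseLink u v w Γ G) (≤-trans m≤M₁ (≮⇒≥ many))
      a = proj₁ sample
      witness : ∀ i → ∃ λ B → ∃ λ C → Sparse (D * Γ) (link u v w G (a i)) B C
      witness i with sparse? (D * Γ) (link u v w G (a i)) | proj₂ (proj₂ sample) i
      ... | yes p | _ = p
      B C : Fin m → Subset M
      B i = proj₁ (witness i)
      C i = proj₁ (proj₂ (witness i))
      sparse : ∀ i → Sparse (D * Γ) (link u v w G (a i)) (B i) (C i)
      sparse i = proj₂ (proj₂ (witness i))
      M≡4^mPW : M ≡ 4 ^ m * (P * W)
      M≡4^mPW = trans M≡ (trans (cong (P *_) M₁≡) (ring P (4 ^ m) W))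
        where
        ring : ∀ p x w → p * (x * w) ≡ x * (p * w)
        ring = solve-∀
      g : ∀ i → size (B i) * size (C i) ≤ Γ * inBox (lookup (B i)) (lookup (C i)) G
      g i = dense (B i) (C i) (proj₁ (sparse i)) (proj₁ (proj₂ (sparse i)))
      G-large : ∀ i → M * M ≤ Θ * inBox (lookup (B i)) (lookup (C i)) G
      G-large i = M²≤ Γ≤ (proj₁ (sparse i)) (proj₁ (proj₂ (sparse i))) (g i)
      blue-small : ∀ i → 16 * r * inBox (lookup (B i)) (lookup (C i)) (link u v w G (a i))
                           ≤ inBox (lookup (B i)) (lookup (C i)) G
      blue-small i = subst (λ z → z * x ≤ inBox (lookup (B i)) (lookup (C i)) G) D≡ (*-cancelˡ-≤ Γ {{>-nonZero 1≤Γ}} (begin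
        Γ * (D * x) ≡⟨ ring Γ D x ⟩
        D * Γ * x ≤⟨ <⇒≤ (proj₂ (proj₂ (sparse i))) ⟩
        size (B i) * size (C i) ≤⟨ g i ⟩
        Γ * inBox (lookup (B i)) (lookup (C i)) G ∎))
        where
        open ≤-Reasoning
        x = inBox (lookup (B i)) (lookup (C i)) (link u v w G (a i))
        ring : ∀ a b c → a * (b * c) ≡ b * a * c
        ring = solve-∀

    -- `G-sound`, `S-sound` and `embedded` concern edges whose first one, first two or all three
    -- vertices are already embedded. Values of `f` from `k` on are arbitrary.
    record State (k : ℕ) : Set where
      field
        f : Fin t → Fin M
        G : Fin t → Fin t → Fin M → Fin M → Bool
        S : Fin t → Fin M → Bool
        G-sound : ∀ x v w b c → toℕ x < k → edge x v w ≡ true → G v w b c ≡ true →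
          blue x v w (f x) b c ≡ true
        S-sound : ∀ x y v q → toℕ y < k → edge x y v ≡ true → S v q ≡ true →
          blue x y v (f x) (f y) q ≡ true
        embedded : ∀ x y z → toℕ z < k → edge x y z ≡ true →
          blue x y z (f x) (f y) (f z) ≡ true
        G-dense : ∀ v w → Dense (D ^ codegree k v w) (G v w)
        S-large : ∀ v → M ≤ count (S v) * D ^ cuts k v

    start : State 0
    start = record
      -- A default image: each value is overwritten before a soundness field refers to it.
      { f = λ _ → F.fromℕ< 1≤M ; G = λ _ _ _ _ → true ; S = λ _ _ → true
      ; G-sound = λ _ _ _ _ _ () ; S-sound = λ _ _ _ _ () ; embedded = λ _ _ _ ()
      ; G-dense = λ v w → subst (λ z → Dense (D ^ z) (λ _ _ → true)) (sym (before-0 {t} (λ x → ⟦ edge x v w ⟧))) complete-dense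
      ; S-large = λ v → ≤-reflexive (sym (trans (cong₂ (λ x y → x * D ^ y) (count-true M) (before-0 {t} (λ y → codegree (toℕ y) y v)))
                                                 (*-identityʳ M))) }

    module Step (u : Fin t) (state : State (toℕ u)) where
      open State state

      e : Fin t → ℕ
      e v = codegree (toℕ u) u v

      -- The guard keeps only those `v` that lie in an edge with `u` and an earlier vertex. There
      -- are at most `d` of them, which keeps the count of bad points independent of `t`.
      badDegree : Fin t → Fin M → Bool
      badDegree v p = (1 ≤ᵇ e v) ∧ lowDegree (D ^ e v) (S v) (G u v) p

      badLink : Fin t → Fin t → Fin M → Bool
      badLink v w p = edge u v w ∧ sparseLink u v w (D ^ codegree (toℕ u) v w) (G v w) p

      candidates : ∀ v → suc (2 * d) * M₁ ≤ count (S v)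
      candidates v = *-cancelʳ-≤ _ _ (D ^ d) {{>-nonZero (D^>0 d)}} (begin
        suc (2 * d) * M₁ * D ^ d ≡⟨ ring (suc (2 * d)) M₁ (D ^ d) ⟩
        suc (2 * d) * D ^ d * M₁ ≡⟨ trans M≡ (cong (_* M₁) P≡) ⟨
        M ≤⟨ S-large v ⟩
        count (S v) * D ^ cuts (toℕ u) v ≤⟨ *-monoʳ-≤ (count (S v)) (^-monoʳ-≤ D {{>-nonZero 1≤D}} (cuts≤d (toℕ u) v)) ⟩
        count (S v) * D ^ d ∎)
        where
        open ≤-Reasoning
        ring : ∀ a b c → a * b * c ≡ a * c * b
        ring = solve-∀

      M₁≤candidates : ∀ v → M₁ ≤ count (S v)
      M₁≤candidates v = ≤-trans (m≤m+n M₁ _) (candidates v)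

      -- The factor `e v` allows summation over all `v`, since the sum of `e` is at most `d`.
      few-badDegree : ∀ v → count (badDegree v) ≤ M₁ * e v
      few-badDegree v with e v | G-dense u v
      ... | zero | _ = ≤-trans (≤-reflexive (∑-zero M)) z≤n
      ... | suc n | dense = ≤-trans (<⇒≤ (few-lowDegree {D ^ suc n} {G u v} (S v) dense (M₁≤candidates v))) (m≤m*n M₁ (suc n))

      few-badLink : ∀ v w → RedK33 χ s ⊎ count (badLink v w) ≤ M₁ * ⟦ edge u v w ⟧
      few-badLink v w with edge u v w in eq
      ... | false = inj₂ (≤-trans (≤-reflexive (∑-zero M)) z≤n)
      ... | true = Sum.map₂ (λ few → ≤-trans (<⇒≤ few) (≤-reflexive (sym (*-identityʳ M₁))))
          (few-sparseLink (proj₁ (edge-< {u} {v} {w} eq)) (proj₂ (edge-< {u} {v} {w} eq)) (D^>0 (codegree (toℕ u) v w))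
            (^-monoʳ-≤ D {{>-nonZero 1≤D}} (codegree≤d (toℕ u) v w)) (G-dense v w))

      bad : Fin M → ℕ
      bad p = ∑ (λ v → ⟦ badDegree v p ⟧) + ∑ (λ v → ∑ λ w → ⟦ badLink v w p ⟧)

      few-bad : (∀ v w → count (badLink v w) ≤ M₁ * ⟦ edge u v w ⟧) → ∑ bad < count (S u)
      few-bad few = begin-strict
        ∑ bad ≡⟨ ∑-+ _ _ ⟩
        ∑ (λ p → ∑ λ v → ⟦ badDegree v p ⟧) + ∑ (λ p → ∑ λ v → ∑ λ w → ⟦ badLink v w p ⟧)
          ≡⟨ cong₂ _+_ (∑-swap _) (∑∑-swap₃ _) ⟩
        ∑ (λ v → count (badDegree v)) + ∑ (λ v → ∑ λ w → count (badLink v w))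
          ≤⟨ +-mono-≤ (∑-mono few-badDegree) (∑-mono λ v → ∑-mono λ w → few v w) ⟩
        ∑ (λ v → M₁ * e v) + ∑ (λ v → ∑ λ w → M₁ * ⟦ edge u v w ⟧)
          ≡⟨ cong₂ _+_ (∑-* M₁ e) (trans (∑-cong λ v → ∑-* M₁ _) (∑-* M₁ _)) ⟩
        M₁ * ∑ e + M₁ * ∑ (λ v → ∑ λ w → ⟦ edge u v w ⟧)
          ≤⟨ +-mono-≤ (*-monoʳ-≤ M₁ ∑e≤d) (*-monoʳ-≤ M₁ (degree-first u)) ⟩
        -- The 1 in `2d + 1` gives the strict inequality.
        M₁ * d + M₁ * d <⟨ m<n+m _ 1≤M₁ ⟩
        M₁ + (M₁ * d + M₁ * d) ≡⟨ ring M₁ d ⟩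
        suc (2 * d) * M₁ ≤⟨ candidates u ⟩
        count (S u) ∎
        where
        open ≤-Reasoning
        ring : ∀ a d → a + (a * d + a * d) ≡ (1 + 2 * d) * a
        ring = solve-∀
        ∑e≤d : ∑ e ≤ d
        ∑e≤d = ≤-trans (∑-mono λ v → before≤ (toℕ u) _)
          (≤-trans (≤-reflexive (∑-swap _)) (degree-middle u))

      module Extend (p : Fin M) (p∈S : S u p ≡ true)
        (goodDegree : ∀ v → badDegree v p ≡ false) (goodLink : ∀ v w → badLink v w p ≡ false) where

        f′ : Fin t → Fin M
        f′ = updateAt f u (λ _ → p)
        f′u : f′ u ≡ p
        f′u = updateAt-updates u f
        f′< : ∀ {x} → toℕ x < toℕ u → f′ x ≡ f x
        f′< {x} x<u = updateAt-minimal x u f λ { refl → <-irrefl refl x<u }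

        G′ : Fin t → Fin t → Fin M → Fin M → Bool
        G′ v w = if edge u v w then link u v w (G v w) p else G v w

        -- One cut serves all earlier `x` with `x u v` an edge: by `G-sound`, pairs of `G u v` are
        -- blue with each of their images.
        S′ : Fin t → Fin M → Bool
        S′ v q = if 1 ≤ᵇ e v then S v q ∧ G u v p q else S v q

        G′⊆G : ∀ v w b c → G′ v w b c ≡ true → G v w b c ≡ true
        G′⊆G v w b c h with edge u v w
        ... | true = proj₁ (∧-true h)
        ... | false = h

        S′⊆S : ∀ v q → S′ v q ≡ true → S v q ≡ true
        S′⊆S v q h with 1 ≤ᵇ e v
        ... | true = proj₁ (∧-true h)
        ... | false = h

        earlier : ∀ {x} → toℕ x < suc (toℕ u) → toℕ x < toℕ u ⊎ x ≡ u
        earlier {x} x≤u = Sum.map₂ toℕ-injective (m≤n⇒m<n∨m≡n (≤-pred x≤u))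

        e-positive : ∀ {x v} → toℕ x < toℕ u → edge x u v ≡ true → 1 ≤ e v
        e-positive {x} {v} x<u edg = ≤-trans (≤-reflexive (sym one)) (term≤∑ _ x)
          where
          one : ⟦ toℕ x <ᵇ toℕ u ⟧ * ⟦ edge x u v ⟧ ≡ 1
          one = cong₂ (λ a b → ⟦ a ⟧ * ⟦ b ⟧) (T⇒≡ (<⇒<ᵇ x<u)) edg

        G′-sound : ∀ x v w b c → toℕ x < suc (toℕ u) → edge x v w ≡ true → G′ v w b c ≡ true →
          blue x v w (f′ x) b c ≡ true
        G′-sound x v w b c x≤u edg h with earlier x≤u
        ... | inj₁ x<u rewrite f′< x<u = G-sound x v w b c x<u edg (G′⊆G v w b c h)
        ... | inj₂ refl rewrite f′u | edg = proj₂ (∧-true h)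

        S′-sound : ∀ x y v q → toℕ y < suc (toℕ u) → edge x y v ≡ true → S′ v q ≡ true →
          blue x y v (f′ x) (f′ y) q ≡ true
        S′-sound x y v q y≤u edg h with earlier y≤u
        ... | inj₁ y<u rewrite f′< y<u | f′< (<-trans (proj₁ (edge-< {x} {y} {v} edg)) y<u) =
          S-sound x y v q y<u edg (S′⊆S v q h)
        ... | inj₂ refl rewrite f′u | f′< (proj₁ (edge-< {x} {u} {v} edg))
                              | T⇒≡ (≤⇒≤ᵇ (e-positive (proj₁ (edge-< {x} {u} {v} edg)) edg)) =
          G-sound x u v p q (proj₁ (edge-< {x} {u} {v} edg)) edg (proj₂ (∧-true h))

        embedded′ : ∀ x y z → toℕ z < suc (toℕ u) → edge x y z ≡ true →
          blue x y z (f′ x) (f′ y) (f′ z) ≡ true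
        embedded′ x y z z≤u edg with edge-< {x} {y} {z} edg | earlier z≤u
        ... | x<y , y<z | inj₁ z<u
          rewrite f′< z<u | f′< (<-trans y<z z<u) | f′< (<-trans x<y (<-trans y<z z<u)) =
          embedded x y z z<u edg
        ... | x<y , y<u | inj₂ refl
          rewrite f′u | f′< y<u | f′< (<-trans x<y y<u) = S-sound x y u p y<u edg p∈S

        G′-dense : ∀ v w → Dense (D ^ codegree (suc (toℕ u)) v w) (G′ v w)
        G′-dense v w = subst (λ k → Dense (D ^ k) (G′ v w)) (sym (before-suc u _)) dense
          where
          dense : Dense (D ^ (codegree (toℕ u) v w + ⟦ edge u v w ⟧)) (G′ v w)
          dense with edge u v w | goodLink v w
          ... | false | _ = subst (λ k → Dense (D ^ k) (G v w)) (sym (+-identityʳ (codegree (toℕ u) v w))) (G-dense v w)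
          ... | true | good with sparse? (D * D ^ codegree (toℕ u) v w) (link u v w (G v w) p)
          -- `good` excludes the other answer, and one edge costs exactly one factor `D`.
          ...   | no ¬sparse = subst (λ k → Dense (D ^ k) (link u v w (G v w) p)) (+-comm 1 (codegree (toℕ u) v w))
              (¬sparse⇒dense {D ^ suc (codegree (toℕ u) v w)} {link u v w (G v w) p} ¬sparse)

        S′-large : ∀ v → M ≤ count (S′ v) * D ^ cuts (suc (toℕ u)) v
        S′-large v = subst (λ k → M ≤ count (S′ v) * D ^ k) (sym (before-suc u _))
          (≤-trans (S-large v) (≤-trans (*-monoˡ-≤ (D ^ cuts (toℕ u) v) large) (≤-reflexive (begin
            count (S′ v) * D ^ e v * D ^ cuts (toℕ u) v ≡⟨ *-assoc (count (S′ v)) (D ^ e v) _ ⟩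
            count (S′ v) * (D ^ e v * D ^ cuts (toℕ u) v) ≡⟨ cong (count (S′ v) *_) (*-comm (D ^ e v) _) ⟩
            count (S′ v) * (D ^ cuts (toℕ u) v * D ^ e v) ≡⟨ cong (count (S′ v) *_) (^-distribˡ-+-* D (cuts (toℕ u) v) (e v)) ⟨
            count (S′ v) * D ^ (cuts (toℕ u) v + e v) ∎))))
          where
          open ≡-Reasoning
          large : count (S v) ≤ count (S′ v) * D ^ e v
          large with 1 ≤ᵇ e v | goodDegree v
          ... | false | _ = m≤m*n (count (S v)) (D ^ e v) {{>-nonZero (D^>0 (e v))}}
          ... | true | good = ≤-trans (<ᵇ-false good) (≤-reflexive (*-comm (D ^ e v) _))

        extended : State (suc (toℕ u))
        extended = record
          { f = f′ ; G = G′ ; S = S′ ; G-sound = G′-sound ; S-sound = S′-sound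
          ; embedded = embedded′ ; G-dense = G′-dense ; S-large = S′-large }

      step : RedK33 χ s ⊎ State (suc (toℕ u))
      step = Sum.map₂ extend (∀⊎ λ v → ∀⊎ λ w → few-badLink v w)
        where
        extend : (∀ v w → count (badLink v w) ≤ M₁ * ⟦ edge u v w ⟧) → State (suc (toℕ u))
        extend few = Extend.extended p p∈S
          (λ v → none (λ v → badDegree v p) (m+n≡0⇒m≡0 _ bad≡0) v)
          (λ v w → none (λ w → badLink v w p)
            (n≤0⇒n≡0 (subst (∑ (λ w → ⟦ badLink v w p ⟧) ≤_) (m+n≡0⇒n≡0 _ bad≡0) (term≤∑ (λ v → ∑ λ w → ⟦ badLink v w p ⟧) v))) w)
          where
          -- A point with `bad p` below its indicator in `S u` is a candidate and has no defect at
          -- all, since the indicator is at most 1.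
          choice = ∑-< bad (λ p → ⟦ S u p ⟧) (few-bad few)
          p = proj₁ choice
          p∈S = ⟦⟧-pos (≤-trans (s≤s z≤n) (proj₂ choice))
          bad≡0 : bad p ≡ 0
          bad≡0 = n≤0⇒n≡0 (≤-pred (≤-trans (proj₂ choice) (⟦⟧≤1 (S u p))))
          none : ∀ {n} (X : Fin n → Bool) → count X ≡ 0 → ∀ i → X i ≡ false
          none X eq i = ⟦⟧-zero (n≤0⇒n≡0 (subst (⟦ X i ⟧ ≤_) eq (term≤∑ (λ i → ⟦ X i ⟧) i)))

    build : ∀ k → k ≤ t → RedK33 χ s ⊎ State k
    build zero _ = inj₂ start
    build (suc k) k<t with build k (<⇒≤ k<t)
    ... | inj₁ red = inj₁ red
    ... | inj₂ state = subst (λ z → RedK33 χ s ⊎ State (suc z)) (toℕ-fromℕ< k<t)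
      (Step.step (F.fromℕ< k<t) (subst State (sym (toℕ-fromℕ< k<t)) state))

    blueCopy : State t → BlueCopy χ H
    blueCopy state =
      (λ i → combine i (f i)) , (λ i j i<j → combine-monoˡ-< (f i) (f j) i<j) ,
      λ i j k inc e → not-true (embedded i j k (toℕ<n k) (∧-intro inc e))
      where
      open State state

  arrows : ∀ {t} (H : Hypergraph3 t) → MaxDegreeAtMost H d → Arrows (t * M) H s
  arrows {t} H deg≤d χ with build H deg≤d χ t ≤-refl
  ... | inj₁ red = inj₂ red
  ... | inj₂ state = inj₁ (blueCopy H deg≤d χ state)

-- Numerical estimates.

integerRoot : ∀ b s → 1 ≤ b → 1 ≤ s → ∃ λ r → 1 ≤ r × r ^ b ≤ s × s < suc r ^ b
integerRoot b@(suc _) (suc zero) _ _ = 1 , ≤-refl , ≤-reflexive (^-zeroˡ b) , ^-monoʳ-≤ 2 {1} {b} (s≤s z≤n)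
integerRoot b@(suc _) (suc s@(suc _)) 1≤b _ with integerRoot b s 1≤b (s≤s z≤n)
... | r , 1≤r , lo , hi with suc s <? suc r ^ b
...   | yes hi′ = r , 1≤r , ≤-trans lo (n≤1+n s) , hi′
...   | no ¬hi = suc r , s≤s z≤n , ≮⇒≥ ¬hi , ≤-<-trans hi (^-monoˡ-< b ≤-refl)

-- Bernoulli's inequality for the `k`-th power of 1 - 1/(1 + ρ), with denominators cleared.
bernoulli : ∀ ρ k → suc ρ ^ k * suc ρ ≤ ρ ^ k * suc ρ + k * suc ρ ^ k
bernoulli ρ zero = ≤-reflexive (sym (+-identityʳ _))
bernoulli ρ (suc k) = begin
  suc ρ * suc ρ ^ k * suc ρ ≡⟨ ring₁ ρ (suc ρ ^ k) ⟩
  suc ρ * (suc ρ ^ k * suc ρ) ≤⟨ *-monoʳ-≤ (suc ρ) (bernoulli ρ k) ⟩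
  suc ρ * (ρ ^ k * suc ρ + k * suc ρ ^ k) ≡⟨ ring₂ ρ (ρ ^ k) k (suc ρ ^ k) ⟩
  ρ * ρ ^ k * suc ρ + k * (suc ρ * suc ρ ^ k) + suc ρ * ρ ^ k
    ≤⟨ +-monoʳ-≤ (ρ * ρ ^ k * suc ρ + k * (suc ρ * suc ρ ^ k)) (*-monoʳ-≤ (suc ρ) (^-monoˡ-≤ k (n≤1+n ρ))) ⟩
  ρ * ρ ^ k * suc ρ + k * (suc ρ * suc ρ ^ k) + suc ρ * suc ρ ^ k
    ≡⟨ ring₃ (ρ * ρ ^ k * suc ρ) k (suc ρ * suc ρ ^ k) ⟩
  ρ * ρ ^ k * suc ρ + suc k * (suc ρ * suc ρ ^ k) ∎
  where
  open ≤-Reasoning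
  ring₁ : ∀ p x → (1 + p) * x * (1 + p) ≡ (1 + p) * (x * (1 + p))
  ring₁ = solve-∀
  ring₂ : ∀ p x k y → (1 + p) * (x * (1 + p) + k * y) ≡ p * x * (1 + p) + k * ((1 + p) * y) + (1 + p) * x
  ring₂ = solve-∀
  ring₃ : ∀ a k y → a + k * y + y ≡ a + (1 + k) * y
  ring₃ = solve-∀

-- Bernoulli's inequality with exponent `r`: the `r`-th power of 1 - 1/(2r) is at least 1/2.
half-power : ∀ {r ρ} → 1 ≤ r → suc ρ ≡ 2 * r → (2 * r) ^ r ≤ 2 * ρ ^ r
half-power {r} {ρ} 1≤r 1+ρ≡2r = *-cancelˡ-≤ r {{>-nonZero 1≤r}} (+-cancelʳ-≤ (r * (2 * r) ^ r) _ _ (begin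
  r * (2 * r) ^ r + r * (2 * r) ^ r ≡⟨ ring r ((2 * r) ^ r) ⟩
  (2 * r) ^ r * (2 * r) ≤⟨ subst (λ z → z ^ r * z ≤ ρ ^ r * z + r * z ^ r) 1+ρ≡2r (bernoulli ρ r) ⟩
  ρ ^ r * (2 * r) + r * (2 * r) ^ r ≡⟨ cong (_+ r * (2 * r) ^ r) (ring′ r (ρ ^ r)) ⟩
  r * (2 * ρ ^ r) + r * (2 * r) ^ r ∎))
  where
  open ≤-Reasoning
  ring : ∀ r x → r * x + r * x ≡ x * (2 * r)
  ring = solve-∀
  ring′ : ∀ r x → x * (2 * r) ≡ r * (2 * x)
  ring′ = solve-∀

power-loss : ∀ {r ρ s q} → 1 ≤ r → suc ρ ≡ 2 * r → s ≤ r * q → (2 * r) ^ s ≤ 2 ^ q * ρ ^ s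
power-loss {r} {ρ} {s} {q} 1≤r 1+ρ≡2r s≤rq = *-cancelʳ-≤ _ _ (ρ ^ k) {{m^n≢0 ρ k {{>-nonZero 1≤ρ}}}} (begin
  -- The exponent is padded from `s` to `r * q`, so that `half-power` applies `q` times.
  (2 * r) ^ s * ρ ^ k ≤⟨ *-monoʳ-≤ ((2 * r) ^ s) (^-monoˡ-≤ k (subst (ρ ≤_) 1+ρ≡2r (n≤1+n ρ))) ⟩
  (2 * r) ^ s * (2 * r) ^ k ≡⟨ ^-distribˡ-+-* (2 * r) s k ⟨
  (2 * r) ^ (s + k) ≡⟨ cong ((2 * r) ^_) s+k ⟩
  (2 * r) ^ (r * q) ≡⟨ ^-*-assoc (2 * r) r q ⟨
  ((2 * r) ^ r) ^ q ≤⟨ ^-monoˡ-≤ q (half-power 1≤r 1+ρ≡2r) ⟩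
  (2 * ρ ^ r) ^ q ≡⟨ ^-distrib-* 2 (ρ ^ r) q ⟩
  2 ^ q * (ρ ^ r) ^ q ≡⟨ cong (2 ^ q *_) (^-*-assoc ρ r q) ⟩
  2 ^ q * ρ ^ (r * q) ≡⟨ cong (λ z → 2 ^ q * ρ ^ z) s+k ⟨
  2 ^ q * ρ ^ (s + k) ≡⟨ cong (2 ^ q *_) (^-distribˡ-+-* ρ s k) ⟩
  2 ^ q * (ρ ^ s * ρ ^ k) ≡⟨ *-assoc (2 ^ q) (ρ ^ s) (ρ ^ k) ⟨
  2 ^ q * ρ ^ s * ρ ^ k ∎)
  where
  open ≤-Reasoning
  k = r * q ∸ s
  s+k : s + k ≡ r * q
  s+k = m+[n∸m]≡n s≤rq
  1≤ρ : 1 ≤ ρ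
  1≤ρ = ≤-pred (subst (2 ≤_) (sym 1+ρ≡2r) (*-monoʳ-≤ 2 1≤r))

n≤2^n : ∀ n → n ≤ 2 ^ n
n≤2^n zero = z≤n
n≤2^n (suc n) = begin
  1 + n ≤⟨ +-mono-≤ (m^n>0 2 n) (n≤2^n n) ⟩
  2 ^ n + 2 ^ n ≡⟨ cong (2 ^ n +_) (+-identityʳ (2 ^ n)) ⟨
  2 ^ suc n ∎
  where open ≤-Reasoning

-- A record, so that the exponents can be inferred.
record _≤2^_ (x k : ℕ) : Set where
  constructor bounded
  field bound : x ≤ 2 ^ k

infix 4 _≤2^_
infixr 7 _*≤2^_
_*≤2^_ : ∀ {x y k l} → x ≤2^ k → y ≤2^ l → x * y ≤2^ k + l
_*≤2^_ {k = k} {l} (bounded p) (bounded q) =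
  bounded (≤-trans (*-mono-≤ p q) (≤-reflexive (sym (^-distribˡ-+-* 2 k l))))

^≤2^ : ∀ {x k} n → x ≤2^ k → x ^ n ≤2^ k * n
^≤2^ {k = k} n (bounded p) = bounded (≤-trans (^-monoˡ-≤ n p) (≤-reflexive (^-*-assoc 2 k n)))

≤2^-self : ∀ n → n ≤2^ n
≤2^-self n = bounded (n≤2^n n)

module Size {s r Q P Θ m T : ℕ} (1≤s : 1 ≤ s) (1≤r : 1 ≤ r) (1≤Q : 1 ≤ Q) (c : ℕ)
  (P≤Θ : P ≤ Θ) (m≡ : m ≡ 16 * Θ * (r * s)) (T≡ : T ≡ 8 * Θ * 2 ^ suc Q) (Θr≤ : Θ * r ≤ c * Q) where

  -- Factors that are not powers of 2 are bounded by `n ≤ 2 ^ n`, and the exponents are added. The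
  -- terms `m` and `Θ * s` are of order `c * Q * s` by `Θr≤`, the term from `T ^ s` by the bound `e`
  -- on the logarithm of `T`.
  side≤ : P * (4 ^ m * (m * (2 * T * ((4 * T) ^ s * s)))) ≤ 2 ^ ((96 * c + 14) * (Q * s))
  side≤ = ≤-trans
    (_≤2^_.bound (P≤ *≤2^ ^≤2^ m 4≤ *≤2^ ≤2^-self m *≤2^ (2≤ *≤2^ T≤) *≤2^ ^≤2^ s (4≤ *≤2^ T≤) *≤2^ ≤2^-self s))
    (^-monoʳ-≤ 2 exponent)
    where
    e = 3 + Θ + suc Q
    2≤ : 2 ≤2^ 1
    2≤ = bounded ≤-refl
    4≤ : 4 ≤2^ 2
    4≤ = bounded ≤-refl
    8≤ : 8 ≤2^ 3
    8≤ = bounded ≤-refl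
    T≤ : T ≤2^ e
    T≤ = subst (_≤2^ e) (sym T≡) ((8≤ *≤2^ ≤2^-self Θ) *≤2^ bounded ≤-refl)
    P≤ : P ≤2^ Θ
    P≤ = bounded (≤-trans P≤Θ (n≤2^n Θ))
    open ≤-Reasoning
    m≤ : m ≤ 16 * c * (Q * s)
    m≤ = begin
      m ≡⟨ m≡ ⟩
      16 * Θ * (r * s) ≡⟨ ring Θ r s ⟩
      16 * (Θ * r) * s ≤⟨ *-monoˡ-≤ s (*-monoʳ-≤ 16 Θr≤) ⟩
      16 * (c * Q) * s ≡⟨ ring′ c Q s ⟩
      16 * c * (Q * s) ∎
      where
      ring : ∀ a r s → 16 * a * (r * s) ≡ 16 * (a * r) * s
      ring = solve-∀
      ring′ : ∀ a r s → 16 * (a * r) * s ≡ 16 * a * (r * s)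
      ring′ = solve-∀
    Θs≤m : Θ * s ≤ m
    Θs≤m = begin
      Θ * s ≡⟨ ring Θ s ⟩
      1 * Θ * (1 * s) ≤⟨ *-mono-≤ (*-monoˡ-≤ Θ {1} {16} (s≤s z≤n)) (*-monoˡ-≤ s 1≤r) ⟩
      16 * Θ * (r * s) ≡⟨ m≡ ⟨
      m ∎
      where
      ring : ∀ a s → a * s ≡ 1 * a * (1 * s)
      ring = solve-∀
    Θ≤m : Θ ≤ m
    Θ≤m = ≤-trans (m≤m*n Θ s {{>-nonZero 1≤s}}) Θs≤m
    s≤Qs : s ≤ Q * s
    s≤Qs = m≤n*m s Q {{>-nonZero 1≤Q}}
    Q≤Qs : Q ≤ Q * s
    Q≤Qs = m≤m*n Q s {{>-nonZero 1≤s}}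
    1≤Qs : 1 ≤ Q * s
    1≤Qs = *-mono-≤ 1≤Q 1≤s
    -- The contributions of `m` and `Θ` amount to six times `m`, hence `96 = 6 * 16`; the remaining
    -- terms add up to 14 times `Q * s`.
    exponent : Θ + (2 * m + (m + (1 + e + ((2 + e) * s + s)))) ≤ (96 * c + 14) * (Q * s)
    exponent = begin
      Θ + (2 * m + (m + (1 + e + ((2 + e) * s + s)))) ≡⟨ ring Θ m Q s ⟩
      Θ + Θ + Θ * s + 3 * m + (Q + 5 * 1 + Q * s + 7 * s)
        ≤⟨ +-mono-≤ (+-monoˡ-≤ (3 * m) (+-mono-≤ (+-mono-≤ Θ≤m Θ≤m) Θs≤m))
             (+-mono-≤ (+-monoˡ-≤ (Q * s) (+-mono-≤ Q≤Qs (*-monoʳ-≤ 5 1≤Qs))) (*-monoʳ-≤ 7 s≤Qs)) ⟩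
      m + m + m + 3 * m + (Q * s + 5 * (Q * s) + Q * s + 7 * (Q * s)) ≡⟨ ring′ m (Q * s) ⟩
      6 * m + 14 * (Q * s) ≤⟨ +-monoˡ-≤ (14 * (Q * s)) (*-monoʳ-≤ 6 m≤) ⟩
      6 * (16 * c * (Q * s)) + 14 * (Q * s) ≡⟨ ring″ c (Q * s) ⟩
      (96 * c + 14) * (Q * s) ∎
      where
      ring : ∀ a m q s → a + (2 * m + (m + (1 + (3 + a + (1 + q)) + ((2 + (3 + a + (1 + q))) * s + s))))
        ≡ a + a + a * s + 3 * m + (q + 5 * 1 + q * s + 7 * s)
      ring = solve-∀
      ring′ : ∀ m q → m + m + m + 3 * m + (q + 5 * q + q + 7 * q) ≡ 6 * m + 14 * q
      ring′ = solve-∀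
      ring″ : ∀ c q → 6 * (16 * c * q) + 14 * q ≡ (96 * c + 14) * q
      ring″ = solve-∀

root-≤ : ∀ {x y} b → 1 ≤ b → x ^ b ≤ y ^ b → x ≤ y
root-≤ b 1≤b le = ≮⇒≥ λ y<x → <⇒≱ (^-monoˡ-< b {{>-nonZero 1≤b}} y<x) le

-- With `b = 1 + x`, the bound `s < (1 + r) ^ b` and `1 + r ≤ 2r` give `Q ≤ s / r ≤ 2 s^(1 - 1/b)`,
-- so the exponent is at most `2 C₁ s^(2 - 1/b)`. Roots are avoided by comparing `b`-th powers,
-- multiplied by `s`.
leTimesPow2 : ∀ {t M C₁ s r Q} x → 1 ≤ s → 1 ≤ r → Q * r ≤ s → s < suc r ^ suc x →
  M ≤ 2 ^ (C₁ * (Q * s)) → LeTimesPow2 t (2 * C₁) s (suc (2 * x)) (suc x) (t * M)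
leTimesPow2 {t} {M} {C₁} {s} {r} {Q} x 1≤s 1≤r Qr≤s s< M≤ v μ _ hyp = begin
  (t * M) ^ v ≡⟨ ^-distrib-* t M v ⟩
  t ^ v * M ^ v ≤⟨ *-monoʳ-≤ (t ^ v) (^-monoˡ-≤ v M≤) ⟩
  t ^ v * (2 ^ L) ^ v ≡⟨ cong (t ^ v *_) (^-*-assoc 2 L v) ⟩
  t ^ v * 2 ^ (L * v) ≤⟨ *-monoʳ-≤ (t ^ v) (^-monoʳ-≤ 2 Lv≤μ) ⟩
  t ^ v * 2 ^ μ ∎
  where
  open ≤-Reasoning
  L = C₁ * (Q * s)
  b = suc x
  C = 2 * C₁
  exponents : s ^ b * s ^ b ≡ s ^ suc (2 * x) * s
  exponents = trans (sym (^-distribˡ-+-* s b b)) (trans (cong (s ^_) (ring x)) (*-comm s _))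
    where
    ring : ∀ x → 1 + x + (1 + x) ≡ 1 + (1 + 2 * x)
    ring = solve-∀
  scaled : L * v * suc r ≤ v * C * (s * s)
  scaled = begin
    L * v * suc r ≡⟨ ring₁ C₁ Q s v r ⟩
    v * C₁ * s * (Q * (1 + r)) ≤⟨ *-monoʳ-≤ (v * C₁ * s) (*-monoʳ-≤ Q (+-monoˡ-≤ r 1≤r)) ⟩
    v * C₁ * s * (Q * (r + r)) ≡⟨ ring₂ C₁ Q s v r ⟩
    v * C * (s * (Q * r)) ≤⟨ *-monoʳ-≤ (v * C) (*-monoʳ-≤ s Qr≤s) ⟩
    v * C * (s * s) ∎
    where
    ring₁ : ∀ c q s v r → c * (q * s) * v * (1 + r) ≡ v * c * s * (q * (1 + r))
    ring₁ = solve-∀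
    ring₂ : ∀ c q s v r → v * c * s * (q * (r + r)) ≡ v * (2 * c) * (s * (q * r))
    ring₂ = solve-∀
  Lv≤μ : L * v ≤ μ
  Lv≤μ = root-≤ b (s≤s z≤n) (*-cancelʳ-≤ _ _ s {{>-nonZero 1≤s}} (begin
    (L * v) ^ b * s ≤⟨ *-monoʳ-≤ ((L * v) ^ b) (<⇒≤ s<) ⟩
    (L * v) ^ b * suc r ^ b ≡⟨ ^-distrib-* (L * v) (suc r) b ⟨
    (L * v * suc r) ^ b ≤⟨ ^-monoˡ-≤ b scaled ⟩
    (v * C * (s * s)) ^ b ≡⟨ ^-distrib-* (v * C) (s * s) b ⟩
    (v * C) ^ b * (s * s) ^ b ≡⟨ cong ((v * C) ^ b *_) (trans (^-distrib-* s s b) exponents) ⟩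
    (v * C) ^ b * (s ^ suc (2 * x) * s) ≡⟨ *-assoc ((v * C) ^ b) _ s ⟨
    (v * C) ^ b * s ^ suc (2 * x) * s ≤⟨ *-monoˡ-≤ s hyp ⟩
    μ ^ b * s ∎))

-- Choice of the parameters.

theorem1 : Σ ℕ λ p → Σ ℕ λ q → 1 ≤ p × 1 ≤ q ×
    ((d : ℕ) → 1 ≤ d → Σ ℕ λ C →
    (t : ℕ) (H : Hypergraph3 t) → MaxDegreeAtMost H d →
    (s : ℕ) → 1 ≤ s →
    ORamseyAtMost H s
    (LeTimesPow2 t C s (q + 2 * p * d ^ 2) (q + p * d ^ 2)))
-- The exponent (1 + 8d²)/(1 + 4d²) is 2 - 1/(1 + 4d²), so the absolute constant is 4.
theorem1 = 4 , 1 , s≤s z≤n , s≤s z≤n , λ d 1≤d → C d , λ t H deg≤d s 1≤s → ramsey d 1≤d H deg≤d s 1≤s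
  where
  c C₁ C : ℕ → ℕ
  -- The coefficient of the power `r ^ (3d)` in `Θ`.
  c d = suc (2 * d) * suc (2 * d) * (16 ^ d * 16 ^ d * 16 ^ d)
  C₁ d = 96 * c d + 14
  C d = 2 * C₁ d

  ramsey : ∀ d → 1 ≤ d → ∀ {t} (H : Hypergraph3 t) → MaxDegreeAtMost H d → ∀ s → 1 ≤ s →
    ORamseyAtMost H s (LeTimesPow2 t (C d) s (1 + 2 * 4 * d ^ 2) (1 + 4 * d ^ 2))
  ramsey d 1≤d {t} H deg≤d s 1≤s with integerRoot (1 + 4 * d ^ 2) s (s≤s z≤n) 1≤s
  ... | r , 1≤r , r^b≤s , s<[1+r]^b = t * M , arrows H deg≤d ,
      subst (λ a → LeTimesPow2 t (C d) s (1 + a) (1 + 4 * d ^ 2) (t * M)) (sym (*-assoc 2 4 (d ^ 2)))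
        (leTimesPow2 {t} {M} {C₁ d} {Q = Q} (4 * d ^ 2) 1≤s 1≤r Qr≤s s<[1+r]^b M≤)
    where
    instance
      r≢0 : NonZero r
      r≢0 = >-nonZero 1≤r
    -- With r = ⌊s^(1/(1+x))⌋ the two losses s·r^x and s²/r are both at most of order s·Q.
    x Q ρ Λ D P Θ m T W M₁ M : ℕ
    x = 4 * d ^ 2
    Q = s / r
    ρ = pred (2 * r)
    -- The successor makes up for the rounding in `Q`: `s` is at most `r * suc Q`.
    Λ = 2 ^ suc Q
    D = 16 * r
    P = suc (2 * d) * D ^ d
    Θ = P * P * D ^ d
    m = 16 * Θ * (r * s)
    T = 8 * Θ * Λ
    W = m * (2 * T * ((4 * T) ^ s * s))
    M₁ = 4 ^ m * W
    M = P * M₁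

    r^x≤Q : r ^ x ≤ Q
    r^x≤Q = subst (_≤ Q) (m*n/n≡m (r ^ x) r) (/-monoˡ-≤ r (subst (_≤ s) (*-comm r (r ^ x)) r^b≤s))

    1≤Q : 1 ≤ Q
    1≤Q = ≤-trans (m^n>0 r x) r^x≤Q

    Qr≤s : Q * r ≤ s
    Qr≤s = m/n*n≤m s r

    s≤r[1+Q] : s ≤ r * suc Q
    s≤r[1+Q] = begin
      s ≡⟨ m≡m%n+[m/n]*n s r ⟩
      s % r + Q * r ≤⟨ +-monoˡ-≤ (Q * r) (<⇒≤ (m%n<n s r)) ⟩
      r + Q * r ≡⟨ *-comm (suc Q) r ⟩
      r * suc Q ∎
      where open ≤-Reasoning

    1+ρ≡2r : suc ρ ≡ 2 * r
    1+ρ≡2r = suc-pred (2 * r) {{>-nonZero (*-mono-≤ {1} {2} (s≤s z≤n) 1≤r)}}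

    1≤D^d : 1 ≤ D ^ d
    1≤D^d = m^n>0 D {{>-nonZero (*-mono-≤ {1} {16} (s≤s z≤n) 1≤r)}} d

    1≤P : 1 ≤ P
    1≤P = *-mono-≤ {1} {suc (2 * d)} (s≤s z≤n) 1≤D^d

    P≤Θ : P ≤ Θ
    P≤Θ = ≤-trans (m≤m*n P P {{>-nonZero 1≤P}}) (m≤m*n (P * P) (D ^ d) {{>-nonZero 1≤D^d}})

    1≤Θ : 1 ≤ Θ
    1≤Θ = ≤-trans 1≤P P≤Θ

    1≤T : 1 ≤ T
    1≤T = *-mono-≤ (*-mono-≤ {1} {8} (s≤s z≤n) 1≤Θ) (m^n>0 2 (suc Q))

    1≤W : 1 ≤ W
    1≤W = *-mono-≤ (*-mono-≤ (*-mono-≤ {1} {16} (s≤s z≤n) 1≤Θ) (*-mono-≤ 1≤r 1≤s))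
      (*-mono-≤ (*-mono-≤ {1} {2} (s≤s z≤n) 1≤T)
        (*-mono-≤ (m^n>0 (4 * T) {{>-nonZero (*-mono-≤ {1} {4} (s≤s z≤n) 1≤T)}} s) 1≤s))

    -- `Θ * r` has degree `3d + 1` in `r` and has to be of order at most `r ^ x`, which `Q`
    -- dominates; this is what `x = 4d²` is chosen for.
    3d+1≤x : d + d + d + 1 ≤ x
    3d+1≤x = begin
      d + d + d + 1 ≤⟨ +-monoʳ-≤ (d + d + d) 1≤d ⟩
      d + d + d + d ≡⟨ ring d ⟩
      4 * (d * 1) ≤⟨ *-monoʳ-≤ 4 (*-monoʳ-≤ d (subst (1 ≤_) (sym (*-identityʳ d)) 1≤d)) ⟩
      x ∎
      where
      open ≤-Reasoning
      ring : ∀ d → d + d + d + d ≡ 4 * (d * 1)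
      ring = solve-∀

    Θr≤cQ : Θ * r ≤ c d * Q
    Θr≤cQ = begin
      Θ * r ≡⟨ cong (λ z → suc (2 * d) * z * (suc (2 * d) * z) * z * r) (^-distrib-* 16 r d) ⟩
      suc (2 * d) * (16 ^ d * r ^ d) * (suc (2 * d) * (16 ^ d * r ^ d)) * (16 ^ d * r ^ d) * r
        ≡⟨ ring (suc (2 * d)) (16 ^ d) (r ^ d) r ⟩
      c d * (r ^ d * r ^ d * r ^ d * r ^ 1) ≡⟨ cong (c d *_) powers ⟩
      c d * r ^ (d + d + d + 1) ≤⟨ *-monoʳ-≤ (c d) (≤-trans (^-monoʳ-≤ r 3d+1≤x) r^x≤Q) ⟩
      c d * Q ∎
      where
      open ≤-Reasoning
      ring : ∀ n a b r → n * (a * b) * (n * (a * b)) * (a * b) * r ≡ n * n * (a * a * a) * (b * b * b * (r * 1))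
      ring = solve-∀
      powers : r ^ d * r ^ d * r ^ d * r ^ 1 ≡ r ^ (d + d + d + 1)
      powers = sym (trans (^-distribˡ-+-* r (d + d + d) 1) (cong (_* r ^ 1)
        (trans (^-distribˡ-+-* r (d + d) d) (cong (_* r ^ d) (^-distribˡ-+-* r d d)))))

    M≤ : M ≤ 2 ^ (C₁ d * (Q * s))
    M≤ = Size.side≤ {s} {r} {Q} {P} {Θ} {m} {T} 1≤s 1≤r 1≤Q (c d) P≤Θ refl refl Θr≤cQ

    open Embedding {d} {s} {r} {Λ} {ρ} {W} {D} {P} {Θ} {m} {M₁} {M} 1≤s 1≤r (m^n>0 2 (suc Q)) 1≤W
      refl refl refl refl refl refl 1+ρ≡2r (power-loss 1≤r 1+ρ≡2r s≤r[1+Q]) ≤-refl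
      using (arrows)
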